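{- Let $q=p^{2r+1}$, where $p$ is a prime and $r$ is a non-negative integer. If $A \subseteq \mathbb{F}_q$ is such that $2p^r<|A|<\sqrt{q}$, then $$\left|\frac{A-A}{A-A}\right| >\frac{|A|^2}{2}.$$
   Context: $\mathbb{F}_q$ is the finite field with $q$ elements. For sets $A,B\subseteq\mathbb{F}_q$, $A-B=\{a-b: a\in A, b\in B\}$ and $\frac{A}{B}=A/B=\{a/b: a\in A, b\in B\}\subseteq \mathbb{F}_q\cup\{\infty\}$, where $a/0$ is defined to be $\infty$ for each $a\in\mathbb{F}_q$. -}

module Defs where

open import Level using (Level; _⊔_)
open import Algebra.Apartness.Bundles using (HeytingField)
open import Data.Fin.Base using (Fin)
open import Data.Maybe.Base using (Maybe; just; nothing)
import Data.Maybe.Relation.Binary.Pointwise as Pointwise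
open import Data.Nat.Base using (ℕ)
open import Data.Product.Base using (Σ; ∃₂; _×_; proj₁)
open import Function.Bundles using (Inverse)
open import Relation.Binary.Bundles using (Setoid)
import Relation.Binary.Construct.On as On
import Relation.Binary.PropositionalEquality.Properties as ≡
open import Relation.Unary using (Pred; _∈_)

private
  variable
    a ℓ p : Level

HasCardinality : Setoid a ℓ → ℕ → Set (a ⊔ ℓ)
HasCardinality S n = Inverse S (≡.setoid (Fin n))

-- The elements of S satisfying P, compared by the equality of S only:
-- the membership proofs do not contribute to the cardinality.
subsetoid : (S : Setoid a ℓ) → Pred (Setoid.Carrier S) p → Setoid (a ⊔ p) ℓ
subsetoid S P = On.setoid {B = Σ (Setoid.Carrier S) P} S proj₁

SubsetHasCardinality : (S : Setoid a ℓ) → Pred (Setoid.Carrier S) p → ℕ →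
                       Set (a ⊔ ℓ ⊔ p)
SubsetHasCardinality S P n = HasCardinality (subsetoid S P) n

-- On a finite carrier, a Heyting field is the same thing as a field in the
-- usual sense: equality is decidable there, and x # y holds exactly when x and
-- y are different.  The zero ring is excluded, since `invertible⇒#` would make
-- its element apart from itself.
module FieldSubsets {c ℓ₁ ℓ₂} (F : HeytingField c ℓ₁ ℓ₂) where

  open HeytingField F using (_#_; 0#; _*_; _-_; #⇒invertible)
  open HeytingField F public using (Carrier; _≈_; setoid)

  -- F ∪ {∞}, with `nothing` as ∞.
  F∪∞ : Setoid c (c ⊔ ℓ₁)
  F∪∞ = Pointwise.setoid setoid

  -- `#⇒invertible` yields an inverse of b - 0#, which equals b.
  inverse : ∀ {b} → b # 0# → Carrier
  inverse b#0 = proj₁ (#⇒invertible b#0)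

  -- IsQuotient x y z: z is x / y in F ∪ {∞}, where x / 0 = ∞ for every x,
  -- including x = 0.
  data IsQuotient (x y : Carrier) : Maybe Carrier → Set (c ⊔ ℓ₁ ⊔ ℓ₂) where
    finite   : ∀ {z} (y#0 : y # 0#) → z ≈ x * inverse y#0 → IsQuotient x y (just z)
    infinite : y ≈ 0# → IsQuotient x y nothing

  infixl 6 _⊖_
  infixl 7 _⊘_

  _⊖_ : Pred Carrier p → Pred Carrier p → Pred Carrier (c ⊔ ℓ₁ ⊔ p)
  (A ⊖ B) z = ∃₂ λ x y → x ∈ A × y ∈ B × z ≈ x - y

  _⊘_ : Pred Carrier p → Pred Carrier p → Pred (Maybe Carrier) (c ⊔ ℓ₁ ⊔ ℓ₂ ⊔ p)
  (A ⊘ B) z = ∃₂ λ x y → x ∈ A × y ∈ B × IsQuotient x y z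

-- Let l be the number of y in F which are not slopes, so that there are q + 1 - l
-- directions, including ∞.  For such y the |A|² values b - a y (a, b ∈ A) are
-- distinct, hence ∏ (X - (b - a y)) divides X^q - X, and the expansion
-- of ∏ 1/(1 - (b - a y) T) has no term in T^i for q - |A|² < i < q - 1.  The
-- coefficient of T^i is a polynomial in y of degree at most i, so for i < l it
-- vanishes identically in that range.  Truncating the expansion at y = 0 gives a
-- multiple G = X^q + g of Q^|A|, where Q = ∏ (X - b) and deg g ≤ q - l.
-- If all exponents in G were divisible by p^(r+1), then G = S(X^(p^(r+1))) with
-- deg S = p^r < |A|, contradicting that S has the |A| distinct roots b^(p^(r+1)).
-- So some exponent is p^e t with e ≤ r and p ∤ t.  With m = p^e, the m-th Hasse
-- derivative of G is nonzero, as p ∤ C(p^e t, m); it has degree at most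
-- q - l - m, as p divides C(q, m); and it is divisible by Q^(|A| - m).  Hence
-- q - l ≥ m + |A| (|A| - m) ≥ |A|²/2, as 2m ≤ 2p^r < |A|.
module Submission where

open import Defs
open import Level using (Level; _⊔_)
open import Algebra.Apartness.Bundles using (HeytingCommutativeRing; HeytingField)
open import Algebra.Bundles using (CommutativeRing)
import Algebra.Properties.AbelianGroup as AbelianGroupProperties
import Algebra.Properties.CommutativeMonoid.Mult as CommutativeMonoidMult
import Algebra.Properties.CommutativeMonoid.Sum as Summation
import Algebra.Properties.Group as GroupProperties
import Algebra.Properties.Monoid.Mult as Mult
import Algebra.Properties.Ring as RingProperties
import Algebra.Properties.Semiring.Exp as Exp
import Algebra.Properties.Semiring.Mult as SemiringMult
import Algebra.Solver.Ring.NaturalCoefficients.Default as SemiringSolver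
open import Data.Bool.Base using (if_then_else_)
open import Data.Fin.Base using (Fin; zero; suc; fromℕ<; punchIn)
open import Data.Fin.Permutation using (Permutation′; permutation; _⟨$⟩ʳ_)
import Data.Fin.Properties as Fin
open import Data.List.Base using (List; []; _∷_; _++_; length; map; concat; replicate; lookup; filter; tabulate; allFin; cartesianProduct)
open import Data.List.Properties using (length-++; length-map; length-tabulate; map-++)
open import Data.List.Membership.Propositional.Properties using (∈-lookup)
import Data.List.Membership.Setoid as MembershipSetoid
import Data.List.Membership.Setoid.Properties as Membership
open import Data.List.Relation.Binary.Pointwise as Pointwise using (Pointwise; []; _∷_)
open import Data.List.Relation.Unary.All as All using (All; []; _∷_)
import Data.List.Relation.Unary.All.Properties as All
open import Data.List.Relation.Unary.AllPairs using ([]; _∷_)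
open import Data.List.Relation.Unary.Any as Any using (here; there)
open import Data.List.Relation.Unary.Any.Properties using (lookup-index)
import Data.List.Relation.Unary.Unique.Propositional.Properties as UniquePropositional
import Data.List.Relation.Unary.Unique.Setoid as UniqueSetoid
import Data.List.Relation.Unary.Unique.Setoid.Properties as Unique
open import Data.Maybe.Base using (Maybe; just; nothing)
import Data.Maybe.Relation.Binary.Pointwise as Maybe
open import Data.Nat.Base as ℕ using (ℕ; zero; suc; pred; _∸_; _<_; _≤_; z≤n; s≤s; z<s; s≤s⁻¹; s<s⁻¹; NonZero; >-nonZero; nonTrivial⇒n>1)
open import Data.Nat.Combinatorics using (_C_; nCk+nC[k+1]≡[n+1]C[k+1]; k>n⇒nCk≡0)
open import Data.Nat.Coprimality using (Coprime; coprime-Bézout)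
open import Data.Nat.Divisibility using (_∣_; _∣?_; _∣0; divides; ∣1⇒≡1; ∣m+n∣m⇒∣n; ∣⇒≤; *-cancelʳ-∣; *-monoˡ-∣; m∣m*n; ∣-trans)
open import Data.Nat.GCD using (module Bézout)
open import Data.Nat.Primality using (Prime; euclidsLemma; prime⇒irreducible; prime⇒nonTrivial; prime⇒nonZero)
import Data.Nat.Properties as ℕ
open import Data.Nat.Solver using (module +-*-Solver)
open import Data.Product.Base using (Σ; ∃; ∃₂; ∃-syntax; _×_; _,_; proj₁; proj₂)
open import Data.Sum.Base using (inj₁; inj₂; [_,_]′)
open import Data.Vec.Functional using (removeAt)
open import Function.Base using (_∘_)
open import Function.Bundles using (Inverse)
open import Relation.Binary.Bundles using (Setoid)
open import Relation.Binary.Definitions using (Decidable; _Respects_)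
open import Relation.Binary.PropositionalEquality as ≡ using (_≡_; _≢_)
open import Relation.Nullary using (¬_; yes; no; does)
open import Relation.Nullary.Decidable using (map′; ¬?; _×-dec_)
open import Relation.Nullary.Negation using (contradiction)
open import Relation.Unary using (Pred)
import Relation.Unary as U

-- Cardinalities from lists without repetitions.

lookup-injective : ∀ {a ℓ} (S : Setoid a ℓ) {xs} → UniqueSetoid.Unique S xs →
                   ∀ i j → Setoid._≈_ S (lookup xs i) (lookup xs j) → i ≡ j
lookup-injective S (x∉ ∷ xs!) zero    zero    _ = ≡.refl
lookup-injective S (x∉ ∷ xs!) zero    (suc j) x≈ = contradiction x≈ (All.lookup x∉ (∈-lookup j))
lookup-injective S (x∉ ∷ xs!) (suc i) zero    ≈x = contradiction (Setoid.sym S ≈x) (All.lookup x∉ (∈-lookup i))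
lookup-injective S (x∉ ∷ xs!) (suc i) (suc j) ≈  = ≡.cong suc (lookup-injective S xs! i j ≈)

list⇒cardinality : ∀ {a ℓ p} (S : Setoid a ℓ) {P : Pred (Setoid.Carrier S) p} {xs} →
                   UniqueSetoid.Unique S xs → All P xs → (∀ {x} → P x → MembershipSetoid._∈_ S x xs) →
                   SubsetHasCardinality S P (length xs)
list⇒cardinality S {P} {xs} xs! Pxs ∈xs = record
  { to        = λ { (x , Px) → Any.index (∈xs Px) }
  ; from      = λ i → lookup xs i , All.lookup Pxs (∈-lookup i)
  -- The index found may depend on the membership proof; as `xs` has no repetitions, equal elements
  -- still get the same index.
  ; to-cong   = λ { {x , Px} {y , Py} x≈y → lookup-injective S xs! _ _
                      (trans (sym (lookup-index (∈xs Px))) (trans x≈y (lookup-index (∈xs Py)))) }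
  ; from-cong = λ { ≡.refl → refl }
  ; inverse   = (λ { {i} {x , Px} x≈ → lookup-injective S xs! _ _
                       (trans (sym (lookup-index (∈xs Px))) x≈) })
              , (λ { {x , Px} ≡.refl → sym (lookup-index (∈xs Px)) })
  }
  where open Setoid S

cardinality⇒dec : ∀ {a ℓ} (S : Setoid a ℓ) {n} → HasCardinality S n → Decidable (Setoid._≈_ S)
cardinality⇒dec S S↔Fin x y = map′
  (λ to≡ → trans (sym (strictlyInverseʳ x)) (trans (reflexive (≡.cong from to≡)) (strictlyInverseʳ y)))
  to-cong (to x Fin.≟ to y)
  where
  open Setoid S
  open Inverse S↔Fin

length-filter-¬ : ∀ {a p} {A : Set a} {P : Pred A p} (P? : U.Decidable P) xs →
                  length (filter P? xs) ℕ.+ length (filter (¬? ∘ P?) xs) ≡ length xs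
length-filter-¬ P? [] = ≡.refl
length-filter-¬ P? (x ∷ xs) with P? x
... | yes _ = ≡.cong suc (length-filter-¬ P? xs)
... | no  _ = ≡.trans (ℕ.+-suc _ _) (≡.cong suc (length-filter-¬ P? xs))

-- The closing inequality in natural numbers.

n²≤2[n∸m]n : ∀ m {n} → 2 ℕ.* m ≤ n → n ℕ.* n ≤ 2 ℕ.* ((n ∸ m) ℕ.* n)
n²≤2[n∸m]n m {n} 2m≤n = begin
  n ℕ.* n                 ≤⟨ ℕ.*-monoˡ-≤ n (begin
    n                    ≡⟨ ℕ.m+n∸n≡m n n ⟨
    n ℕ.+ n ∸ n           ≤⟨ ℕ.∸-monoʳ-≤ (n ℕ.+ n) 2m≤n ⟩
    n ℕ.+ n ∸ 2 ℕ.* m      ≡⟨ ≡.cong (λ k → n ℕ.+ k ∸ 2 ℕ.* m) (≡.sym (ℕ.+-identityʳ n)) ⟩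
    2 ℕ.* n ∸ 2 ℕ.* m      ≡⟨ ℕ.*-distribˡ-∸ 2 n m ⟨
    2 ℕ.* (n ∸ m)         ∎) ⟩
  2 ℕ.* (n ∸ m) ℕ.* n      ≡⟨ ℕ.*-assoc 2 (n ∸ m) n ⟩
  2 ℕ.* ((n ∸ m) ℕ.* n)    ∎
  where open ℕ.≤-Reasoning

-- Here `s` counts the slopes and `l` the other field elements. Cancelling `l` leaves
-- `(n ∸ m) ℕ.* n ≤ s`, and `2 ℕ.* m ≤ n` makes `n ∸ m` at least half of `n`.
n²≤2s : ∀ {n s l q} m → 2 ℕ.* m ≤ n → s ℕ.+ l ≡ q → l ℕ.+ (n ∸ m) ℕ.* n ≤ q → n ℕ.* n ≤ 2 ℕ.* s
n²≤2s {n} {s} {l} {q} m 2m≤n s+l≡q bound = begin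
  n ℕ.* n                ≤⟨ n²≤2[n∸m]n m 2m≤n ⟩
  2 ℕ.* ((n ∸ m) ℕ.* n)   ≤⟨ ℕ.*-monoʳ-≤ 2 (ℕ.+-cancelˡ-≤ l _ _ (begin
    l ℕ.+ (n ∸ m) ℕ.* n   ≤⟨ bound ⟩
    q                   ≡⟨ s+l≡q ⟨
    s ℕ.+ l              ≡⟨ ℕ.+-comm s l ⟩
    l ℕ.+ s              ∎)) ⟩
  2 ℕ.* s                ∎
  where open ℕ.≤-Reasoning

-- Binomial coefficients modulo a prime.

module PrimeBinomials where

  open import Data.Nat.Base using (_+_; _*_; _^_)
  open ≡ using (refl; sym; trans; cong; cong₂; subst; subst₂)

  -- The absorption identity, by induction through Pascal's rule. It turns divisibility of the upper
  -- index into information on the coefficient.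
  [k+1]*[n+1]C[k+1]≡[n+1]*nCk : ∀ n k → suc k * (suc n C suc k) ≡ suc n * (n C k)
  [k+1]*[n+1]C[k+1]≡[n+1]*nCk zero    zero    = refl
  [k+1]*[n+1]C[k+1]≡[n+1]*nCk zero    (suc k) = ℕ.*-zeroʳ (suc (suc k))
  [k+1]*[n+1]C[k+1]≡[n+1]*nCk (suc n) zero    = begin
    1 * (suc (suc n) C 1)        ≡⟨ ℕ.*-identityˡ _ ⟩
    suc (suc n) C 1              ≡⟨ nCk+nC[k+1]≡[n+1]C[k+1] (suc n) 0 ⟨
    1 + suc n C 1                ≡⟨ cong suc (trans (sym (ℕ.*-identityˡ _)) ([k+1]*[n+1]C[k+1]≡[n+1]*nCk n 0)) ⟩
    suc (suc n) * 1              ∎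
    where open ≡.≡-Reasoning
  [k+1]*[n+1]C[k+1]≡[n+1]*nCk (suc n) (suc k) = begin
    suc (suc k) * (suc (suc n) C suc (suc k))
      ≡⟨ cong (suc (suc k) *_) (nCk+nC[k+1]≡[n+1]C[k+1] (suc n) (suc k)) ⟨
    suc (suc k) * (x + suc n C suc (suc k))
      ≡⟨ ℕ.*-distribˡ-+ (suc (suc k)) x _ ⟩
    (x + suc k * x) + suc (suc k) * (suc n C suc (suc k))
      ≡⟨ cong₂ (λ y z → (x + y) + z) ([k+1]*[n+1]C[k+1]≡[n+1]*nCk n k) ([k+1]*[n+1]C[k+1]≡[n+1]*nCk n (suc k)) ⟩
    (x + suc n * (n C k)) + suc n * (n C suc k)
      ≡⟨ ℕ.+-assoc x _ _ ⟩
    x + (suc n * (n C k) + suc n * (n C suc k))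
      ≡⟨ cong (x +_) (ℕ.*-distribˡ-+ (suc n) (n C k) (n C suc k)) ⟨
    x + suc n * (n C k + n C suc k)
      ≡⟨ cong (λ y → x + suc n * y) (nCk+nC[k+1]≡[n+1]C[k+1] n k) ⟩
    suc (suc n) * x ∎
    where
    open ≡.≡-Reasoning
    x = suc n C suc k

  module _ {p} (p-prime : Prime p) where

    private instance
      p≢0 : NonZero p
      p≢0 = prime⇒nonZero p-prime

    -- Euclid's lemma is applied to one factor `p` at a time: it must divide `k`, and is then
    -- cancelled from both sides.
    p^e∣k*c⇒p^e∣k : ∀ e k {c} → ¬ p ∣ c → p ^ e ∣ k * c → p ^ e ∣ k
    p^e∣k*c⇒p^e∣k zero    k     p∤c _       = divides k (sym (ℕ.*-identityʳ k))
    p^e∣k*c⇒p^e∣k (suc e) k {c} p∤c p^e∣k*c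
      with euclidsLemma k c p-prime (∣-trans (m∣m*n (p ^ e)) p^e∣k*c)
    ... | inj₂ p∣c             = contradiction p∣c p∤c
    ... | inj₁ (divides j refl) = subst (_∣ j * p) (ℕ.*-comm (p ^ e) p) (*-monoˡ-∣ p
      (p^e∣k*c⇒p^e∣k e j p∤c (*-cancelʳ-∣ p (subst₂ _∣_ (ℕ.*-comm p (p ^ e)) rearrange p^e∣k*c))))
      where
      rearrange : j * p * c ≡ j * c * p
      rearrange = solve 3 (λ j p c → j :* p :* c := j :* c :* p) refl j p c
        where open +-*-Solver

    -- By absorption `p ^ e` divides `k` times the coefficient. If `p` did not divide the
    -- coefficient, the whole power would divide `k`, which is positive and too small.
    p∣[p^e*t]Ck : ∀ e t {k} → 0 < k → k < p ^ e → p ∣ (p ^ e * t) C k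
    p∣[p^e*t]Ck e t {suc k} _ k<p^e with p ∣? (p ^ e * t) C suc k
    ... | yes p∣C = p∣C
    ... | no  p∤C = contradiction (∣⇒≤ (p^e∣k*c⇒p^e∣k e (suc k) p∤C p^e∣)) (ℕ.<⇒≱ k<p^e)
      where
      p^e∣ : p ^ e ∣ suc k * ((p ^ e * t) C suc k)
      p^e∣ with p ^ e * t in eq
      ... | zero  = subst (p ^ e ∣_) (sym (ℕ.*-zeroʳ (suc k))) ((p ^ e) ∣0)
      ... | suc n = subst (p ^ e ∣_) (sym ([k+1]*[n+1]C[k+1]≡[n+1]*nCk n k))
                      (subst (λ m → p ^ e ∣ m * (n C k)) eq
                        (∣-trans (m∣m*n t) (m∣m*n (n C k))))

    -- Consecutive coefficients `n C k` and `n C suc k` add up to `suc n C suc k`, a multiple of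
    -- `p`; so modulo `p` each is the negative of the one before, starting from 1.
    p∤nCk : ∀ e t {n} → suc n ≡ p ^ e * t → ∀ k → k < p ^ e → ¬ p ∣ n C k
    p∤nCk e t sn≡ zero    _     p∣1 =
      ℕ.<⇒≢ (nonTrivial⇒n>1 p {{prime⇒nonTrivial p-prime}}) (sym (∣1⇒≡1 p∣1))
    p∤nCk e t {n} sn≡ (suc k) k<p^e p∣C =
      p∤nCk e t sn≡ k (ℕ.<-trans (ℕ.n<1+n k) k<p^e)
        (∣m+n∣m⇒∣n (subst (p ∣_) (sym (trans (ℕ.+-comm (n C suc k) _) (nCk+nC[k+1]≡[n+1]C[k+1] n k)))
                      (subst (λ m → p ∣ m C suc k) (sym sn≡) (p∣[p^e*t]Ck e t z<s k<p^e)))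
                   p∣C)

    -- Absorption, with `p ^ e` cancelled, leaves `t * (n C k)` for the predecessors `n` and `k` of
    -- the two indices; `p` divides neither factor.
    p∤[p^e*t]C[p^e] : ∀ e {t} → ¬ p ∣ t → ¬ p ∣ (p ^ e * t) C (p ^ e)
    p∤[p^e*t]C[p^e] e {zero}      p∤0 _ = p∤0 (p ∣0)
    p∤[p^e*t]C[p^e] e {t@(suc _)} p∤t p∣C =
      [ p∤t , p∤nCk e t (ℕ.suc-pred (p ^ e * t)) k (subst (k <_) (ℕ.suc-pred (p ^ e)) (ℕ.n<1+n k)) ]′
        (euclidsLemma t (n C k) p-prime (subst (p ∣_) C≡ p∣C))
      where
      instance
        p^e≢0 = ℕ.m^n≢0 p e
        p^e*t≢0 = ℕ.m*n≢0 (p ^ e) t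
      k = pred (p ^ e)
      n = pred (p ^ e * t)
      C≡ : (p ^ e * t) C (p ^ e) ≡ t * (n C k)
      C≡ = ℕ.*-cancelˡ-≡ _ _ (p ^ e) (begin
        p ^ e * ((p ^ e * t) C (p ^ e)) ≡⟨ cong₂ (λ a b → a * (b C a)) (ℕ.suc-pred (p ^ e)) (ℕ.suc-pred (p ^ e * t)) ⟨
        suc k * (suc n C suc k)         ≡⟨ [k+1]*[n+1]C[k+1]≡[n+1]*nCk n k ⟩
        suc n * (n C k)                 ≡⟨ cong (_* (n C k)) (ℕ.suc-pred (p ^ e * t)) ⟩
        p ^ e * t * (n C k)             ≡⟨ ℕ.*-assoc (p ^ e) t (n C k) ⟩
        p ^ e * (t * (n C k))           ∎)
        where open ≡.≡-Reasoning

    -- Factors `p` are split off until none is left; the assumption on `p ^ suc r` stops this after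
    -- at most `r` of them.
    p-adic-decomposition : ∀ r j → ¬ p ^ suc r ∣ j → ∃₂ λ e t → e ≤ r × j ≡ p ^ e * t × ¬ p ∣ t
    p-adic-decomposition r j p^[1+r]∤j with p ∣? j
    ... | no p∤j = 0 , j , z≤n , sym (ℕ.*-identityˡ j) , p∤j
    p-adic-decomposition zero j p∤j | yes p∣j =
      contradiction (subst (_∣ j) (sym (ℕ.*-identityʳ p)) p∣j) p∤j
    p-adic-decomposition (suc r) j p^[2+r]∤j | yes (divides i refl) =
      let e , t , e≤r , i≡ , p∤t = p-adic-decomposition r i
            (λ p^[1+r]∣i → p^[2+r]∤j (subst (_∣ i * p) (ℕ.*-comm (p ^ suc r) p) (*-monoˡ-∣ p p^[1+r]∣i)))
      in suc e , t , s≤s e≤r ,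
         trans (cong (_* p) i≡) (trans (ℕ.*-comm (p ^ e * t) p) (sym (ℕ.*-assoc p (p ^ e) t))) , p∤t

open PrimeBinomials

-- Power series and the coefficient sequences of polynomials.

module Sequences {c ℓ} (R : CommutativeRing c ℓ) where
  open CommutativeRing R hiding (zero)
  open import Relation.Binary.Reasoning.Setoid setoid
  open SemiringSolver commutativeSemiring using (solve; _:+_; _:*_; _:=_)
  open Exp semiring using (_^_)
  open MembershipSetoid setoid using (_∈_)

  Sequence : Set c
  Sequence = ℕ → Carrier

  infix 4 _≋_
  _≋_ : Sequence → Sequence → Set ℓ
  s ≋ t = ∀ i → s i ≈ t i

  𝟘 𝟙 : Sequence
  𝟘 _ = 0#
  𝟙 zero    = 1#
  𝟙 (suc _) = 0#

  infixl 6 _⊕_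
  _⊕_ : Sequence → Sequence → Sequence
  (s ⊕ t) i = s i + t i

  -- The power series s in T, multiplied and divided by 1 - u T.
  mul quo : Carrier → Sequence → Sequence
  mul u s zero    = s zero
  mul u s (suc i) = s (suc i) + - u * s i
  quo u s zero    = s zero
  quo u s (suc i) = s (suc i) + u * quo u s i

  -- The head of the list is multiplied last but divided out first, so that the two operations
  -- cancel factor by factor.
  mulAll quoAll : List Carrier → Sequence → Sequence
  mulAll []       s = s
  mulAll (u ∷ us) s = mul u (mulAll us s)
  quoAll []       s = s
  quoAll (u ∷ us) s = quoAll us (quo u s)

  -- A sequence s with Degree d e s stands for the polynomial
  -- s₀ Xᵈ⁻ᵉ + s₁ Xᵈ⁻ᵉ⁻¹ + ⋯ of degree at most d - e.  When e = 0, quo u s lists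
  -- the quotient of this polynomial by X - u and, at index d, its value at u.
  Degree : ℕ → ℕ → Sequence → Set ℓ
  Degree d e s = ∀ i → d < i ℕ.+ e → s i ≈ 0#

  -- Congruence modulo `T^k`. Coefficient `i` of `mul` and `quo` depends only on coefficients up to
  -- `i`, so both preserve it; the congruences for `_≋_` follow by letting `k` vary.
  Agree : ℕ → Sequence → Sequence → Set ℓ
  Agree k s t = ∀ i → i < k → s i ≈ t i

  agree⇒≋ : ∀ {s t} → (∀ k → Agree k s t) → s ≋ t
  agree⇒≋ agree i = agree (suc i) i (ℕ.n<1+n i)

  mul-agree : ∀ u {k s t} → Agree k s t → Agree k (mul u s) (mul u t)
  mul-agree u s≈t zero    0<k = s≈t 0 0<k
  mul-agree u s≈t (suc i) i<k =
    +-cong (s≈t (suc i) i<k) (*-congˡ (s≈t i (ℕ.<-trans (ℕ.n<1+n i) i<k)))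

  quo-agree : ∀ {u v k s t} → u ≈ v → Agree k s t → Agree k (quo u s) (quo v t)
  quo-agree u≈v s≈t zero    0<k = s≈t 0 0<k
  quo-agree u≈v s≈t (suc i) i<k =
    +-cong (s≈t (suc i) i<k)
           (*-cong u≈v (quo-agree u≈v s≈t i (ℕ.<-trans (ℕ.n<1+n i) i<k)))

  mulAll-agree : ∀ us {k s t} → Agree k s t → Agree k (mulAll us s) (mulAll us t)
  mulAll-agree []       s≈t = s≈t
  mulAll-agree (u ∷ us) s≈t = mul-agree u (mulAll-agree us s≈t)

  quoAll-agree : ∀ {us vs k s t} → Pointwise _≈_ us vs → Agree k s t →
                 Agree k (quoAll us s) (quoAll vs t)
  quoAll-agree []            s≈t = s≈t
  quoAll-agree (u≈v ∷ us≈vs) s≈t = quoAll-agree us≈vs (quo-agree u≈v s≈t)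

  mul-cong : ∀ u {s t} → s ≋ t → mul u s ≋ mul u t
  mul-cong u s≋t = agree⇒≋ λ k → mul-agree u λ i _ → s≋t i

  quo-cong : ∀ {u v s t} → u ≈ v → s ≋ t → quo u s ≋ quo v t
  quo-cong u≈v s≋t = agree⇒≋ λ k → quo-agree u≈v λ i _ → s≋t i

  mulAll-cong : ∀ us {s t} → s ≋ t → mulAll us s ≋ mulAll us t
  mulAll-cong us s≋t = agree⇒≋ λ k → mulAll-agree us λ i _ → s≋t i

  quoAll-cong : ∀ {us vs s t} → Pointwise _≈_ us vs → s ≋ t → quoAll us s ≋ quoAll vs t
  quoAll-cong us≈vs s≋t = agree⇒≋ λ k → quoAll-agree us≈vs λ i _ → s≋t i

  quoAll-congʳ : ∀ us {s t} → s ≋ t → quoAll us s ≋ quoAll us t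
  quoAll-congʳ us = quoAll-cong {us} (Pointwise.refl refl)

  mul-quo : ∀ u s → mul u (quo u s) ≋ s
  mul-quo u s zero    = refl
  mul-quo u s (suc i) = begin
    (s (suc i) + u * x) + - u * x ≈⟨ +-congˡ (RingProperties.-‿distribˡ-* ring u x) ⟨
    (s (suc i) + u * x) - u * x   ≈⟨ GroupProperties.//-rightDividesʳ +-group (u * x) (s (suc i)) ⟩
    s (suc i)                     ∎
    where x = quo u s i

  quo-mul : ∀ {u v} s → u ≈ v → quo u (mul v s) ≋ s
  quo-mul         s u≈v zero    = refl
  quo-mul {u} {v} s u≈v (suc i) = begin
    (s (suc i) + - v * s i) + u * quo u (mul v s) i
      ≈⟨ +-cong (+-congˡ (sym (RingProperties.-‿distribˡ-* ring v (s i)))) (*-cong u≈v (quo-mul s u≈v i)) ⟩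
    (s (suc i) - v * s i) + v * s i
      ≈⟨ GroupProperties.//-rightDividesˡ +-group (v * s i) (s (suc i)) ⟩
    s (suc i) ∎

  mulAll-quoAll : ∀ us s → mulAll us (quoAll us s) ≋ s
  mulAll-quoAll []       s i = refl
  mulAll-quoAll (u ∷ us) s i =
    trans (mul-cong u (mulAll-quoAll us (quo u s)) i) (mul-quo u s i)

  quoAll-mulAll : ∀ us s → quoAll us (mulAll us s) ≋ s
  quoAll-mulAll []       s i = refl
  quoAll-mulAll (u ∷ us) s i =
    trans (quoAll-congʳ us (quo-mul (mulAll us s) refl) i) (quoAll-mulAll us s i)

  mul-comm : ∀ u v s → mul u (mul v s) ≋ mul v (mul u s)
  mul-comm u v s zero          = refl
  mul-comm u v s (suc zero)    =
    solve 4 (λ u v x y → (y :+ v :* x) :+ u :* x := (y :+ u :* x) :+ v :* x) refl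
      (- u) (- v) (s 0) (s 1)
  mul-comm u v s (suc (suc i)) =
    solve 5 (λ u v x y z → (z :+ v :* y) :+ u :* (y :+ v :* x)
                        := (z :+ u :* y) :+ v :* (y :+ u :* x)) refl
      (- u) (- v) (s i) (s (suc i)) (s (suc (suc i)))

  mul-⊕ : ∀ u s t → mul u (s ⊕ t) ≋ mul u s ⊕ mul u t
  mul-⊕ u s t zero    = refl
  mul-⊕ u s t (suc i) =
    solve 5 (λ u x y x′ y′ → (x :+ y) :+ u :* (x′ :+ y′)
                          := (x :+ u :* x′) :+ (y :+ u :* y′)) refl
      (- u) (s (suc i)) (t (suc i)) (s i) (t i)

  mul-𝟘 : ∀ u → mul u 𝟘 ≋ 𝟘
  mul-𝟘 u zero    = refl
  mul-𝟘 u (suc i) = trans (+-identityˡ _) (zeroʳ _)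

  quo-𝟘 : ∀ u → quo u 𝟘 ≋ 𝟘
  quo-𝟘 u zero    = refl
  quo-𝟘 u (suc i) = trans (+-identityˡ _) (trans (*-congˡ (quo-𝟘 u i)) (zeroʳ u))

  mul-mulAll : ∀ u us s → mul u (mulAll us s) ≋ mulAll us (mul u s)
  mul-mulAll u []       s i = refl
  mul-mulAll u (v ∷ us) s i =
    trans (mul-comm u v (mulAll us s) i) (mul-cong v (mul-mulAll u us s) i)

  mulAll-comm : ∀ us vs s → mulAll us (mulAll vs s) ≋ mulAll vs (mulAll us s)
  mulAll-comm []       vs s i = refl
  mulAll-comm (u ∷ us) vs s i =
    trans (mul-cong u (mulAll-comm us vs s) i) (mul-mulAll u vs (mulAll us s) i)

  mulAll-⊕ : ∀ us s t → mulAll us (s ⊕ t) ≋ mulAll us s ⊕ mulAll us t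
  mulAll-⊕ []       s t i = refl
  mulAll-⊕ (u ∷ us) s t i =
    trans (mul-cong u (mulAll-⊕ us s t) i) (mul-⊕ u (mulAll us s) (mulAll us t) i)

  mulAll-𝟘 : ∀ us → mulAll us 𝟘 ≋ 𝟘
  mulAll-𝟘 []       i = refl
  mulAll-𝟘 (u ∷ us) i = trans (mul-cong u (mulAll-𝟘 us) i) (mul-𝟘 u i)

  quoAll-𝟘 : ∀ us → quoAll us 𝟘 ≋ 𝟘
  quoAll-𝟘 []       i = refl
  quoAll-𝟘 (u ∷ us) i = trans (quoAll-congʳ us (quo-𝟘 u) i) (quoAll-𝟘 us i)

  mulAll-++ : ∀ us vs s → mulAll (us ++ vs) s ≡ mulAll us (mulAll vs s)
  mulAll-++ []       vs s = ≡.refl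
  mulAll-++ (u ∷ us) vs s = ≡.cong (mul u) (mulAll-++ us vs s)

  quo-mul-comm : ∀ u v s → quo u (mul v s) ≋ mul v (quo u s)
  quo-mul-comm u v s i = begin
    quo u (mul v s) i                 ≈⟨ quo-cong refl (mul-cong v (mul-quo u s)) i ⟨
    quo u (mul v (mul u (quo u s))) i ≈⟨ quo-cong refl (mul-comm v u (quo u s)) i ⟩
    quo u (mul u (mul v (quo u s))) i ≈⟨ quo-mul _ refl i ⟩
    mul v (quo u s) i                 ∎

  degree-cong : ∀ {d e s t} → s ≋ t → Degree d e s → Degree d e t
  degree-cong s≋t deg i d<i = trans (sym (s≋t i)) (deg i d<i)

  degree-suc : ∀ {d e s} → Degree d e s → Degree (suc d) (suc e) s
  degree-suc {d} {e} deg i d<i =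
    deg i (s<s⁻¹ (≡.subst (suc d <_) (ℕ.+-suc i e) d<i))

  degree-+ : ∀ k {d e s} → Degree d e s → Degree (k ℕ.+ d) (k ℕ.+ e) s
  degree-+ zero    deg = deg
  degree-+ (suc k) deg = degree-suc (degree-+ k deg)

  mul-degree : ∀ u {d e s} → Degree d (suc e) s → Degree d e (mul u s)
  mul-degree u {d} {e} deg zero    d<e = deg 0 (ℕ.<-trans d<e (ℕ.n<1+n e))
  mul-degree u {d} {e} {s} deg (suc i) d<i+e = begin
    s (suc i) + - u * s i ≈⟨ +-cong (deg (suc i) (ℕ.<-≤-trans d<i+e (ℕ.+-monoʳ-≤ (suc i) (ℕ.n≤1+n e))))
                                    (*-congˡ (deg i (≡.subst (d <_) (≡.sym (ℕ.+-suc i e)) d<i+e))) ⟩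
    0# + - u * 0#         ≈⟨ trans (+-identityˡ _) (zeroʳ _) ⟩
    0#                    ∎

  mulAll-degree : ∀ us {d e s} → Degree d (length us ℕ.+ e) s → Degree d e (mulAll us s)
  mulAll-degree []       deg = deg
  mulAll-degree (u ∷ us) {d} {e} {s} deg =
    mul-degree u (mulAll-degree us
      (≡.subst (λ k → Degree d k s) (≡.sym (ℕ.+-suc (length us) e)) deg))

  -- The resolvent identity `1/(1 - vT) - 1/(1 - uT) = (v - u)T / ((1 - uT)(1 - vT))` in
  -- coefficients, arranged without subtraction. It serves to carry a root `v` other than `u` over
  -- to the quotient by `X - u`.
  quo-resolvent : ∀ u v s i → quo v s (suc i) + u * quo v (quo u s) i
                            ≈ quo u s (suc i) + v * quo v (quo u s) i
  quo-resolvent u v s zero    =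
    solve 4 (λ u v x y → (y :+ v :* x) :+ u :* x := (y :+ u :* x) :+ v :* x) refl
      u v (s 0) (s 1)
  quo-resolvent u v s (suc i) = begin
    (a + v * b′) + u * (b + v * x) ≈⟨ solve 6 (λ u v a b b′ x → (a :+ v :* b′) :+ u :* (b :+ v :* x)
                                                              := (a :+ u :* b) :+ v :* (b′ :+ u :* x))
                                             refl u v a b b′ x ⟩
    (a + u * b) + v * (b′ + u * x) ≈⟨ +-congˡ (*-congˡ (quo-resolvent u v s i)) ⟩
    (a + u * b) + v * (b + v * x)  ∎
    where
    a  = s (suc (suc i))
    b  = quo u s (suc i)
    b′ = quo v s (suc i)
    x  = quo v (quo u s) i

  infixl 6 _⊖_
  _⊖_ : Sequence → Sequence → Sequence
  (s ⊖ t) i = s i - t i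

  monomial : ℕ → Sequence
  monomial zero            = 𝟙
  monomial (suc k) zero    = 0#
  monomial (suc k) (suc i) = monomial k i

  monomial-≢ : ∀ k i → i ≢ k → monomial k i ≈ 0#
  monomial-≢ zero    zero    0≢0   = contradiction ≡.refl 0≢0
  monomial-≢ zero    (suc i) _     = refl
  monomial-≢ (suc k) zero    _     = refl
  monomial-≢ (suc k) (suc i) i≢k   = monomial-≢ k i λ i≡k → i≢k (≡.cong suc i≡k)

  quo-𝟙 : ∀ u i → quo u 𝟙 i ≈ u ^ i
  quo-𝟙 u zero    = refl
  quo-𝟙 u (suc i) = trans (+-identityˡ _) (*-congˡ (quo-𝟙 u i))

  quo-monomial : ∀ u k i → quo u (monomial k) (k ℕ.+ i) ≈ u ^ i
  quo-monomial u zero    i = quo-𝟙 u i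
  quo-monomial u (suc k) i = trans (shift (k ℕ.+ i)) (quo-monomial u k i)
    where
    shift : ∀ i → quo u (monomial (suc k)) (suc i) ≈ quo u (monomial k) i
    shift zero    = trans (+-congˡ (zeroʳ u)) (+-identityʳ _)
    shift (suc i) = +-congˡ (*-congˡ (shift i))

  quo-⊖ : ∀ u s t → quo u (s ⊖ t) ≋ quo u s ⊖ quo u t
  quo-⊖ u s t zero    = refl
  quo-⊖ u s t (suc i) = begin
    (s (suc i) - t (suc i)) + u * quo u (s ⊖ t) i ≈⟨ +-congˡ (*-congˡ (quo-⊖ u s t i)) ⟩
    (s (suc i) - t (suc i)) + u * (x - y)         ≈⟨ +-congˡ (RingProperties.x[y-z]≈xy-xz ring u x y) ⟩
    (s (suc i) - t (suc i)) + (u * x - u * y)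
      ≈⟨ solve 4 (λ a b c d → (a :+ b) :+ (c :+ d) := (a :+ c) :+ (b :+ d)) refl
           (s (suc i)) (- t (suc i)) (u * x) (- (u * y)) ⟩
    (s (suc i) + u * x) + (- t (suc i) - u * y)
      ≈⟨ +-congˡ (AbelianGroupProperties.⁻¹-∙-comm +-abelianGroup (t (suc i)) (u * y)) ⟩
    (s (suc i) + u * x) - (t (suc i) + u * y)     ∎
    where
    x = quo u s i
    y = quo u t i

  truncate : ℕ → Sequence → Sequence
  truncate d s i with i ℕ.≤? d
  ... | yes _ = s i
  ... | no  _ = 0#

  truncate-degree : ∀ d s → Degree d 0 (truncate d s)
  truncate-degree d s i d<i with i ℕ.≤? d
  ... | yes i≤d = contradiction (≡.subst (d <_) (ℕ.+-identityʳ i) d<i) (ℕ.≤⇒≯ i≤d)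
  ... | no  _   = refl

  truncate-agree : ∀ d {k s} → (∀ i → d < i → i < k → s i ≈ 0#) → Agree k (truncate d s) s
  truncate-agree d s≈0 i i<k with i ℕ.≤? d
  ... | yes _   = refl
  ... | no  i≰d = sym (s≈0 i (ℕ.≰⇒> i≰d) i<k)

  -- The conclusion says that `u` is a root: division by `X - u` lowers the degree bound and leaves
  -- no remainder. Indeed `quo u` cancels the factor at `u` and commutes with the other factors.
  quo-mulAll-degree : ∀ {u us d e s} → u ∈ us → Degree d (length us ℕ.+ e) s →
                      Degree d (suc e) (quo u (mulAll us s))
  quo-mulAll-degree {u} {v ∷ us} {d} {e} {s} (here u≈v) deg =
    degree-cong (λ i → sym (quo-mul (mulAll us s) u≈v i))
      (mulAll-degree us (≡.subst (λ k → Degree d k s) (≡.sym (ℕ.+-suc (length us) e)) deg))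
  quo-mulAll-degree {u} {v ∷ us} {d} {e} {s} (there u∈us) deg =
    degree-cong (λ i → sym (quo-mul-comm u v (mulAll us s) i))
      (mul-degree v (quo-mulAll-degree u∈us
        (≡.subst (λ k → Degree d k s) (≡.sym (ℕ.+-suc (length us) e)) deg)))

  -- With P = suc k, the polynomial S (X ^ P) takes the value S (u ^ P) at u.
  quo-decimate : ∀ k u s → (∀ i → ¬ suc k ∣ i → s i ≈ 0#) → ∀ i →
                 quo (u ^ suc k) (λ j → s (suc k ℕ.* j)) i ≈ quo u s (suc k ℕ.* i)
  quo-decimate k u s s≈0 zero = reflexive (≡.trans (≡.cong s (ℕ.*-zeroʳ (suc k)))
                                                   (≡.sym (≡.cong (quo u s) (ℕ.*-zeroʳ (suc k)))))
  quo-decimate k u s s≈0 (suc i) = begin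
    s (suc k ℕ.* suc i) + u ^ suc k * quo (u ^ suc k) _ i
      ≈⟨ +-cong (reflexive (≡.cong s index)) (*-congˡ (quo-decimate k u s s≈0 i)) ⟩
    s (suc (k ℕ.+ m)) + u * u ^ k * quo u s m
      ≈⟨ +-congˡ (*-assoc u (u ^ k) _) ⟩
    s (suc (k ℕ.+ m)) + u * (u ^ k * quo u s m)
      ≈⟨ +-congˡ (*-congˡ (gap k (ℕ.n<1+n k))) ⟨
    quo u s (suc (k ℕ.+ m))
      ≈⟨ reflexive (≡.cong (quo u s) (≡.sym index)) ⟩
    quo u s (suc k ℕ.* suc i) ∎
    where
    m = suc k ℕ.* i
    index : suc k ℕ.* suc i ≡ suc (k ℕ.+ m)
    index = ℕ.*-suc (suc k) i
    -- Between two multiples of `suc k` the coefficients of `s` vanish, so each Horner step only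
    -- multiplies by `u`.
    gap : ∀ j → j < suc k → quo u s (j ℕ.+ m) ≈ u ^ j * quo u s m
    gap zero    _   = sym (*-identityˡ _)
    gap (suc j) j<k = begin
      s (suc j ℕ.+ m) + u * quo u s (j ℕ.+ m)
        ≈⟨ +-congʳ (s≈0 (suc j ℕ.+ m) λ k∣ → ℕ.<⇒≱ j<k (∣⇒≤ (∣m+n∣m⇒∣n (≡.subst (suc k ∣_) (ℕ.+-comm (suc j) m) k∣) (m∣m*n i)))) ⟩
      0# + u * quo u s (j ℕ.+ m)    ≈⟨ +-identityˡ _ ⟩
      u * quo u s (j ℕ.+ m)         ≈⟨ *-congˡ (gap j (ℕ.<-trans (ℕ.n<1+n j) j<k)) ⟩
      u * (u ^ j * quo u s m)      ≈⟨ *-assoc u (u ^ j) _ ⟨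
      u * u ^ j * quo u s m        ∎

-- Polynomial functions and their roots.

module PolynomialFunctions {c ℓ} (R : CommutativeRing c ℓ) where
  open CommutativeRing R hiding (zero)
  open Sequences R
  open import Relation.Binary.Reasoning.Setoid setoid
  open SemiringSolver commutativeSemiring using (solve; _:+_; _:*_; _:=_)

  -- φ is a polynomial function of degree at most d, expressed through iterated
  -- divided differences, so that neither coefficients nor formal polynomials
  -- are needed.
  Polynomial : ℕ → (Carrier → Carrier) → Set (c ⊔ ℓ)
  Polynomial zero    φ = ∀ x y → φ x ≈ φ y
  Polynomial (suc d) φ = ∀ a → Σ (Carrier → Carrier) λ ψ →
                         Polynomial d ψ × (∀ x → φ x ≈ φ a + (x - a) * ψ x)

  Affine : (Carrier → Carrier) → Set (c ⊔ ℓ)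
  Affine α = Σ Carrier λ β → ∀ a x → α x ≈ α a + (x - a) * β

  constant-polynomial : ∀ d k → Polynomial d λ _ → k
  constant-polynomial zero    k x y = refl
  constant-polynomial (suc d) k a   =
    (λ _ → 0#) , constant-polynomial d 0# ,
    λ x → sym (trans (+-congˡ (zeroʳ (x - a))) (+-identityʳ k))

  scale-polynomial : ∀ d k {φ} → Polynomial d φ → Polynomial d λ x → k * φ x
  scale-polynomial zero    k poly x y = *-congˡ (poly x y)
  scale-polynomial (suc d) k {φ} poly a =
    let ψ , poly-ψ , φ≈ = poly a in
    (λ x → k * ψ x) , scale-polynomial d k poly-ψ , λ x →
    trans (*-congˡ (φ≈ x))
          (solve 4 (λ k y w z → k :* (y :+ w :* z) := k :* y :+ w :* (k :* z)) refl
             k (φ a) (x - a) (ψ x))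

  +-polynomial : ∀ d {φ χ} → Polynomial d φ → Polynomial d χ → Polynomial d λ x → φ x + χ x
  +-polynomial zero    poly poly′ x y = +-cong (poly x y) (poly′ x y)
  +-polynomial (suc d) {φ} {χ} poly poly′ a =
    let ψ , poly-ψ , φ≈ = poly a ; ω , poly-ω , χ≈ = poly′ a in
    (λ x → ψ x + ω x) , +-polynomial d poly-ψ poly-ω , λ x →
    trans (+-cong (φ≈ x) (χ≈ x))
          (solve 5 (λ y y′ w z z′ → (y :+ w :* z) :+ (y′ :+ w :* z′)
                                 := (y :+ y′) :+ w :* (z :+ z′)) refl
             (φ a) (χ a) (x - a) (ψ x) (ω x))

  suc-polynomial : ∀ d {φ} → Polynomial d φ → Polynomial (suc d) φ
  suc-polynomial zero {φ} poly a =
    (λ _ → 0#) , constant-polynomial zero 0# ,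
    λ x → trans (poly x a) (sym (trans (+-congˡ (zeroʳ (x - a))) (+-identityʳ (φ a))))
  suc-polynomial (suc d) poly a =
    let ψ , poly-ψ , φ≈ = poly a in ψ , suc-polynomial d poly-ψ , φ≈

  -- The product rule for divided differences: that of the product at `a` is `β * φ x + α a * ψ x`.
  -- For constant `φ` the second term is zero and is left out.
  affine-*-polynomial : ∀ d {α φ} → Affine α → Polynomial d φ →
                        Polynomial (suc d) λ x → α x * φ x
  affine-*-polynomial zero {α} {φ} (β , α≈) poly a =
    (λ x → β * φ x) , scale-polynomial zero β poly , λ x → begin
      α x * φ x                       ≈⟨ *-congʳ (α≈ a x) ⟩
      (α a + (x - a) * β) * φ x       ≈⟨ distribʳ _ _ _ ⟩
      α a * φ x + (x - a) * β * φ x   ≈⟨ +-cong (*-congˡ (poly x a)) (*-assoc _ _ _) ⟩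
      α a * φ a + (x - a) * (β * φ x) ∎
  affine-*-polynomial (suc d) {α} {φ} (β , α≈) poly a =
    let ψ , poly-ψ , φ≈ = poly a in
    (λ x → β * φ x + α a * ψ x) ,
    +-polynomial (suc d) (scale-polynomial (suc d) β poly)
                         (suc-polynomial d (scale-polynomial d (α a) poly-ψ)) , λ x → begin
      α x * φ x                                             ≈⟨ *-congʳ (α≈ a x) ⟩
      (α a + (x - a) * β) * φ x                             ≈⟨ distribʳ _ _ _ ⟩
      α a * φ x + (x - a) * β * φ x                         ≈⟨ +-congʳ (*-congˡ (φ≈ x)) ⟩
      α a * (φ a + (x - a) * ψ x) + (x - a) * β * φ x
        ≈⟨ solve 6 (λ l y w z b y′ → l :* (y :+ w :* z) :+ w :* b :* y′
                                  := l :* y :+ w :* (b :* y′ :+ l :* z)) refl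
             (α a) (φ a) (x - a) (ψ x) β (φ x) ⟩
      α a * φ a + (x - a) * (β * φ x + α a * ψ x)          ∎

  PolynomialSequence : (Carrier → Sequence) → Set (c ⊔ ℓ)
  PolynomialSequence s = ∀ i → Polynomial i λ x → s x i

  -- The recursion of `quo` multiplies by one affine function for each step from `i` to `suc i`, so
  -- degree and index grow together.
  quo-polynomial : ∀ {α s} → Affine α → PolynomialSequence s →
                   PolynomialSequence λ x → quo (α x) (s x)
  quo-polynomial aff poly zero    = poly zero
  quo-polynomial aff poly (suc i) =
    +-polynomial (suc i) (poly (suc i)) (affine-*-polynomial i aff (quo-polynomial aff poly i))

  module Roots (cancel : ∀ {x y} → x * y ≈ 0# → ¬ x ≈ 0# → y ≈ 0#) where

    open UniqueSetoid setoid using (Unique)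

    cancel-- : ∀ {x y z} → ¬ x ≈ y → x * z ≈ y * z → z ≈ 0#
    cancel-- {x} {y} {z} x≉y xz≈yz = cancel
      (trans (RingProperties.[y-z]x≈yx-zx ring z x y) (GroupProperties.x≈y⇒x∙y⁻¹≈ε +-group xz≈yz))
      (λ x-y≈0 → x≉y (GroupProperties.x∙y⁻¹≈ε⇒x≈y +-group x y x-y≈0))

    -- Once a root `a` is split off, `φ x` is `(x - a) * ψ x`, so `ψ` has a smaller degree bound and
    -- vanishes at the remaining points.
    polynomial-vanishes : ∀ d {φ xs} → Polynomial d φ → Unique xs → d < length xs →
                          All (λ x → φ x ≈ 0#) xs → ∀ x → φ x ≈ 0#
    polynomial-vanishes zero    poly _ _ (φa≈0 ∷ _) x = trans (poly x _) φa≈0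
    polynomial-vanishes (suc d) {φ} {a ∷ xs} poly (a∉xs ∷ xs!) d< (φa≈0 ∷ φxs≈0) x =
      let ψ , poly-ψ , φ≈ = poly a
          ψ≈0 : ∀ {y} → ¬ a ≈ y × φ y ≈ 0# → ψ y ≈ 0#
          ψ≈0 {y} (a≉y , φy≈0) = cancel
            (trans (sym (trans (+-congʳ φa≈0) (+-identityˡ _))) (trans (sym (φ≈ y)) φy≈0))
            (λ y-a≈0 → a≉y (sym (GroupProperties.x∙y⁻¹≈ε⇒x≈y +-group y a y-a≈0)))
      in begin
        φ x                 ≈⟨ φ≈ x ⟩
        φ a + (x - a) * ψ x ≈⟨ +-cong φa≈0 (*-congˡ (polynomial-vanishes d poly-ψ xs! (s<s⁻¹ d<)
                                 (All.map ψ≈0 (All.zip (a∉xs , φxs≈0))) x)) ⟩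
        0# + (x - a) * 0#   ≈⟨ trans (+-identityˡ _) (zeroʳ _) ⟩
        0#                  ∎

    -- The roots are divided out one at a time. By `quo-resolvent`, a later root `v` satisfies
    -- `u * x ≈ v * x` for each coefficient `x` that has to vanish, and `u` differs from `v`.
    quoAll-degree : ∀ {us d e s} → Unique us → All (λ u → Degree d (suc e) (quo u s)) us →
                    Degree d e s → Degree d (length us ℕ.+ e) (quoAll us s)
    quoAll-degree [] [] deg = deg
    quoAll-degree {u ∷ us} {d} {e} {s} (u∉us ∷ us!) (root ∷ roots) _ =
      ≡.subst (λ k → Degree d k (quoAll us (quo u s))) (ℕ.+-suc (length us) e)
        (quoAll-degree us! (All.map root′ (All.zip (u∉us , roots))) root)
      where
      root′ : ∀ {v} → ¬ u ≈ v × Degree d (suc e) (quo v s) →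
              Degree d (suc (suc e)) (quo v (quo u s))
      root′ {v} (u≉v , rootᵥ) i d<i = cancel-- u≉v (begin
        u * x                   ≈⟨ trans (+-congʳ (rootᵥ (suc i) d<i′)) (+-identityˡ _) ⟨
        quo v s (suc i) + u * x ≈⟨ quo-resolvent u v s i ⟩
        quo u s (suc i) + v * x ≈⟨ trans (+-congʳ (root (suc i) d<i′)) (+-identityˡ _) ⟩
        v * x                   ∎)
        where
        x = quo v (quo u s) i
        d<i′ = ≡.subst (d <_) (ℕ.+-suc i (suc e)) d<i

-- Hasse derivatives and divisibility by linear factors.

module HasseDerivatives {c ℓ} (R : CommutativeRing c ℓ) where
  open CommutativeRing R hiding (zero)
  open Sequences R
  open import Relation.Binary.Reasoning.Setoid setoid
  open SemiringSolver commutativeSemiring using (solve; _:+_; _:*_; _:=_)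
  open Mult +-monoid using (×-congʳ; ×-congˡ; ×-homo-+) renaming (_×_ to _·_)
  open SemiringMult semiring using (×-comm-*)
  open CommutativeMonoidMult +-commutativeMonoid using (×-distrib-+)

  -- The m-th Hasse derivative of s₀ Xᵈ + s₁ Xᵈ⁻¹ + ⋯, whose leading term is that
  -- in Xᵈ⁻ᵐ.
  hasse : ℕ → ℕ → Sequence → Sequence
  hasse m d s i = ((d ∸ i) C m) · s i

  ·-zeroʳ : ∀ k {x} → x ≈ 0# → k · x ≈ 0#
  ·-zeroʳ zero    x≈0 = refl
  ·-zeroʳ (suc k) x≈0 = trans (+-cong x≈0 (·-zeroʳ k x≈0)) (+-identityˡ 0#)

  pascal : ∀ n k x → (suc n C suc k) · x ≈ (n C suc k) · x + (n C k) · x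
  pascal n k x = begin
    (suc n C suc k) · x            ≈⟨ ×-congˡ (nCk+nC[k+1]≡[n+1]C[k+1] n k) ⟨
    (n C k ℕ.+ n C suc k) · x       ≈⟨ ×-homo-+ x (n C k) (n C suc k) ⟩
    (n C k) · x + (n C suc k) · x  ≈⟨ +-comm _ _ ⟩
    (n C suc k) · x + (n C k) · x  ∎

  hasse-degree : ∀ m {d s} → Degree d 0 s → Degree d m (hasse m d s)
  -- Up to index `d` the binomial is zero for exponents `d ∸ i` below `m`; beyond `d`, where the
  -- subtraction is truncated, `s i` is zero.
  hasse-degree m {d} {s} deg i d<i+m with ℕ.<-≤-connex d i
  ... | inj₁ d<i = ·-zeroʳ ((d ∸ i) C m) (deg i (≡.subst (d <_) (≡.sym (ℕ.+-identityʳ i)) d<i))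
  ... | inj₂ i≤d = ×-congˡ {s i} (k>n⇒nCk≡0 (ℕ.+-cancelˡ-< i (d ∸ i) m
                     (≡.subst (_< i ℕ.+ m) (≡.sym (ℕ.m+[n∸m]≡n i≤d)) d<i+m)))

  hasse-0 : ∀ d s → hasse 0 d s ≋ s
  hasse-0 d s i = +-identityʳ (s i)

  -- The Leibniz rule for a product with `X - b`, whose Hasse derivatives beyond the first vanish.
  -- On coefficients it is Pascal's rule.
  hasse-mul : ∀ m {d s} b → Degree d 0 s →
              hasse (suc m) (suc d) (mul b s) ≋ mul b (hasse (suc m) d s) ⊕ hasse m d s
  hasse-mul m {d} {s} b deg zero    = pascal d m (s 0)
  hasse-mul m {d} {s} b deg (suc j) with ℕ.<-≤-connex j d
  -- Both `d ∸ j` and `d ∸ suc j` are 0 here, so Pascal's rule does not apply; instead `s (suc j)`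
  -- is zero.
  ... | inj₂ d≤j = begin
    (n C suc m) · (s (suc j) + - b * s j)         ≈⟨ ×-congʳ (n C suc m) (trans (+-congʳ s≈0) (+-identityˡ _)) ⟩
    (n C suc m) · (- b * s j)                     ≈⟨ ×-comm-* (n C suc m) (- b) (s j) ⟨
    - b * (n C suc m) · s j                       ≈⟨ +-identityˡ _ ⟨
    0# + - b * (n C suc m) · s j                  ≈⟨ +-congʳ (·-zeroʳ (n′ C suc m) s≈0) ⟨
    (n′ C suc m) · s (suc j) + - b * (n C suc m) · s j
      ≈⟨ +-identityʳ _ ⟨
    (n′ C suc m) · s (suc j) + - b * (n C suc m) · s j + 0#
      ≈⟨ +-congˡ (·-zeroʳ (n′ C m) s≈0) ⟨
    (n′ C suc m) · s (suc j) + - b * (n C suc m) · s j + (n′ C m) · s (suc j) ∎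
    where
    n  = d ∸ j
    n′ = d ∸ suc j
    s≈0 = deg (suc j) (s≤s (≡.subst (d ≤_) (≡.sym (ℕ.+-identityʳ j)) d≤j))
  ... | inj₁ j<d = begin
    (n C suc m) · (s (suc j) + - b * s j)
      ≈⟨ ×-distrib-+ _ _ (n C suc m) ⟩
    (n C suc m) · s (suc j) + (n C suc m) · (- b * s j)
      ≈⟨ +-cong (trans (×-congˡ (≡.cong (_C suc m) n≡)) (pascal n′ m (s (suc j))))
                (sym (×-comm-* (n C suc m) (- b) (s j))) ⟩
    ((n′ C suc m) · s (suc j) + (n′ C m) · s (suc j)) + - b * (n C suc m) · s j
      ≈⟨ solve 3 (λ x y z → (x :+ y) :+ z := (x :+ z) :+ y) refl _ _ _ ⟩
    (n′ C suc m) · s (suc j) + - b * (n C suc m) · s j + (n′ C m) · s (suc j) ∎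
    where
    n  = d ∸ j
    n′ = d ∸ suc j
    n≡ : n ≡ suc n′
    n≡ = ℕ.+-∸-assoc 1 j<d

  -- The polynomial of degree at most d - e given by s is divisible by the product
  -- of the X - u for u in us.
  record Divisible (us : List Carrier) (d e : ℕ) (s : Sequence) : Set (c ⊔ ℓ) where
    constructor divides
    field
      quotient        : Sequence
      equality        : s ≋ mulAll us quotient
      quotient-degree : Degree d (length us ℕ.+ e) quotient

  divisible-cong : ∀ {us d e s t} → s ≋ t → Divisible us d e s → Divisible us d e t
  divisible-cong s≋t (divides w s≋ deg) = divides w (λ i → trans (sym (s≋t i)) (s≋ i)) deg

  divisible-𝟘 : ∀ us d e → Divisible us d e 𝟘
  divisible-𝟘 us d e = divides 𝟘 (λ i → sym (mulAll-𝟘 us i)) λ _ _ → refl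

  divisible-⊕ : ∀ {us d e s t} → Divisible us d e s → Divisible us d e t →
                Divisible us d e (s ⊕ t)
  divisible-⊕ {us} (divides w s≋ deg-w) (divides v t≋ deg-v) =
    divides (w ⊕ v) (λ i → trans (+-cong (s≋ i) (t≋ i)) (sym (mulAll-⊕ us w v i)))
    λ i d<i → trans (+-cong (deg-w i d<i) (deg-v i d<i)) (+-identityˡ 0#)

  divisible-suc : ∀ {us d e s} → Divisible us d e s → Divisible us (suc d) (suc e) s
  divisible-suc {us} {d} {e} (divides w s≋ deg) =
    divides w s≋ (≡.subst (λ k → Degree (suc d) k w) (≡.sym (ℕ.+-suc (length us) e)) (degree-suc deg))

  divisible-mul : ∀ {us d e s} b → Divisible us d e s → Divisible us (suc d) e (mul b s)
  divisible-mul {us} b (divides w s≋ deg) =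
    divides (mul b w) (λ i → trans (mul-cong b s≋ i) (mul-mulAll b us w i)) (mul-degree b (degree-suc deg))

  divisible-mulAll : ∀ {us d e s} bs → Divisible us d e s →
                     Divisible us (length bs ℕ.+ d) e (mulAll bs s)
  divisible-mulAll []       div = div
  divisible-mulAll (b ∷ bs) div = divisible-mul b (divisible-mulAll bs div)

  divisible-++ : ∀ {us d e s} bs → Divisible us d e s →
                 Divisible (bs ++ us) (length bs ℕ.+ d) e (mulAll bs s)
  divisible-++ {us} {d} {e} {s} bs (divides w s≋ deg) =
    divides w
      (λ i → trans (mulAll-cong bs s≋ i) (reflexive (≡.cong (λ f → f i) (≡.sym (mulAll-++ bs us w)))))
      (≡.subst (λ k → Degree (length bs ℕ.+ d) k w) length≡ (degree-+ (length bs) deg))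
    where
    length≡ : length bs ℕ.+ (length us ℕ.+ e) ≡ length (bs ++ us) ℕ.+ e
    length≡ = ≡.trans (≡.sym (ℕ.+-assoc (length bs) (length us) e))
                      (≡.cong (ℕ._+ e) (≡.sym (length-++ bs)))

  divisible-drop : ∀ {us d e s} bs → Divisible (bs ++ us) d e s → Divisible us d e s
  divisible-drop {us} {d} {e} {s} bs (divides w s≋ deg) =
    divides (mulAll bs w)
      (λ i → trans (s≋ i) (trans (reflexive (≡.cong (λ f → f i) (mulAll-++ bs us w))) (mulAll-comm bs us w i)))
      (mulAll-degree bs (≡.subst (λ k → Degree d k w) length≡ deg))
    where
    length≡ : length (bs ++ us) ℕ.+ e ≡ length bs ℕ.+ (length us ℕ.+ e)
    length≡ = ≡.trans (≡.cong (ℕ._+ e) (length-++ bs)) (ℕ.+-assoc (length bs) (length us) e)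

  -- The linear factors of `Q^k`, where `Q` is the product of the `X - u` for `u` in `us`.
  power : ℕ → List Carrier → List Carrier
  power k us = concat (replicate k us)

  divisible-power : ∀ k m {us d e s} → Divisible (power (suc k ∸ m) us) d e s →
                    Divisible (power (k ∸ m) us) d e s
  divisible-power k       zero    {us} div = divisible-drop us div
  divisible-power zero    (suc m) {us} {d} {e} {s} div =
    ≡.subst (λ k → Divisible (power k us) d e s) (ℕ.0∸n≡0 m) div
  divisible-power (suc k) (suc m) div = divisible-power k m div

  -- For `m ≤ k` both lists are the same. Otherwise the exponent `suc k ∸ m` is truncated to 0 and
  -- the surplus factors are dropped.
  divisible-power-++ : ∀ k m {us d e s} → Divisible (us ++ power (k ∸ m) us) d e s →
                       Divisible (power (suc k ∸ m) us) d e s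
  divisible-power-++ k       zero    div = div
  divisible-power-++ zero    (suc m) {us} {d} {e} {s} div =
    ≡.subst (λ k → Divisible (power k us) d e s) (≡.sym (ℕ.0∸n≡0 m)) (divisible-drop us div)
  divisible-power-++ (suc k) (suc m) div = divisible-power-++ k m div

  module _ {us d u} (k : ℕ) (deg : Degree d 0 u)
           (div : ∀ m → Divisible (power (k ∸ m) us) d m (hasse m d u)) where

    -- By the Leibniz rule, the other terms of the derivative contain a derivative of `u` of order
    -- less than `m`, hence a factor `Q^(k + 1 - m)`, with `Q` the product over `us`; they are
    -- collected in `w`.
    hasse-mulAll : ∀ bs m → ∃[ w ] hasse m (length bs ℕ.+ d) (mulAll bs u) ≋ mulAll bs (hasse m d u) ⊕ w ×
                                   Divisible (power (suc k ∸ m) us) (length bs ℕ.+ d) m w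
    hasse-mulAll bs zero =
      𝟘 , (λ i → trans (hasse-0 (length bs ℕ.+ d) (mulAll bs u) i)
                       (trans (mulAll-cong bs (λ j → sym (hasse-0 d u j)) i) (sym (+-identityʳ _)))) ,
      divisible-𝟘 (power (suc k) us) (length bs ℕ.+ d) 0
    hasse-mulAll [] (suc m) =
      𝟘 , (λ i → sym (+-identityʳ _)) , divisible-𝟘 (power (k ∸ m) us) d (suc m)
    hasse-mulAll (b ∷ bs) (suc m) =
      let w , w≋ , div-w = hasse-mulAll bs (suc m)
          v , v≋ , div-v = hasse-mulAll bs m
          d′ = length bs ℕ.+ d
      in mul b w ⊕ (mulAll bs (hasse m d u) ⊕ v) , (λ i → begin
        hasse (suc m) (suc d′) (mul b (mulAll bs u)) i
          ≈⟨ hasse-mul m b (mulAll-degree bs (degree-+ (length bs) deg)) i ⟩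
        mul b (hasse (suc m) d′ (mulAll bs u)) i + hasse m d′ (mulAll bs u) i
          ≈⟨ +-cong (trans (mul-cong b w≋ i) (mul-⊕ b (mulAll bs (hasse (suc m) d u)) w i)) (v≋ i) ⟩
        (mul b (mulAll bs (hasse (suc m) d u)) i + mul b w i) + (mulAll bs (hasse m d u) i + v i)
          ≈⟨ +-assoc _ _ _ ⟩
        mul b (mulAll bs (hasse (suc m) d u)) i + (mul b w i + (mulAll bs (hasse m d u) i + v i)) ∎) ,
      divisible-⊕ (divisible-mul b div-w)
                  (divisible-suc (divisible-⊕ (divisible-mulAll bs (div m)) (divisible-power k m div-v)))

  -- Induction on `k`, by `hasse-mulAll` with `us` as the new factors: the main term gains one more
  -- `Q` from them, and the remainder already has enough.
  hasse-divisible : ∀ k {us d s} → Degree d 0 s → ∀ m →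
    Divisible (power (k ∸ m) us) (length (power k us) ℕ.+ d) m
              (hasse m (length (power k us) ℕ.+ d) (mulAll (power k us) s))
  hasse-divisible zero {us} {d} {s} deg m =
    ≡.subst (λ k → Divisible (power k us) d m (hasse m d s)) (≡.sym (ℕ.0∸n≡0 m))
      (divides (hasse m d s) (λ _ → refl) (hasse-degree m deg))
  hasse-divisible (suc k) {us} {d} {s} deg m =
    ≡.subst₂ (λ d t → Divisible (power (suc k ∸ m) us) d m (hasse m d t))
      (≡.trans (≡.sym (ℕ.+-assoc (length us) (length (power k us)) d)) (≡.cong (ℕ._+ d) (≡.sym (length-++ us))))
      (≡.sym (mulAll-++ us (power k us) s))
      (divisible-cong (λ i → sym (w≋ i))
        (divisible-⊕ (divisible-power-++ k m (divisible-++ us (hasse-divisible k deg m))) div-w))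
    where
    hasse≋ = hasse-mulAll k (mulAll-degree (power k us) (degree-+ (length (power k us)) deg))
                            (hasse-divisible k {us} deg) us m
    w≋    = proj₁ (proj₂ hasse≋)
    div-w = proj₂ (proj₂ hasse≋)

-- Finite fields: the characteristic and the identity `x^q = x`.

record IsField {c ℓ} (R : CommutativeRing c ℓ) : Set (c ⊔ ℓ) where
  open CommutativeRing R
  field
    1≉0    : ¬ 1# ≈ 0#
    invert : ∀ x → ¬ x ≈ 0# → ∃ λ y → x * y ≈ 1#

module FiniteField {c ℓ} (R : CommutativeRing c ℓ) (isField : IsField R)
  {q : ℕ} (F↔Fin : HasCardinality (CommutativeRing.setoid R) q) where

  open CommutativeRing R hiding (zero)
  open IsField isField
  open Inverse F↔Fin using (to; from; to-cong; strictlyInverseˡ; strictlyInverseʳ)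
  open Sequences R
  open PolynomialFunctions R
  open import Relation.Binary.Reasoning.Setoid setoid
  open SemiringSolver commutativeSemiring using (solve; _:+_; _:*_; _:=_)
  open Exp semiring using (_^_)
  open SemiringMult semiring using (×-congˡ; ×-congʳ; ×-assoc-*; ×1-homo-*) renaming (_×_ to _·_)
  private
    module Σ₊ = Summation +-commutativeMonoid
    module Σ* = Summation *-commutativeMonoid

  infix 4 _≟_
  -- Abstract, so that x ≟ y stays in a form that with can match.
  abstract
    _≟_ : Decidable _≈_
    _≟_ = cardinality⇒dec setoid F↔Fin

  cancel : ∀ {x y} → x * y ≈ 0# → ¬ x ≈ 0# → y ≈ 0#
  cancel {x} {y} xy≈0 x≉0 = let x⁻¹ , xx⁻¹≈1 = invert x x≉0 in begin
    y              ≈⟨ *-identityˡ y ⟨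
    1# * y         ≈⟨ *-congʳ xx⁻¹≈1 ⟨
    x * x⁻¹ * y    ≈⟨ solve 3 (λ x z y → x :* z :* y := z :* (x :* y)) refl x x⁻¹ y ⟩
    x⁻¹ * (x * y)  ≈⟨ trans (*-congˡ xy≈0) (zeroʳ x⁻¹) ⟩
    0#             ∎

  open Roots cancel

  permute : (f g : Carrier → Carrier) → (∀ {x y} → x ≈ y → f x ≈ f y) → (∀ {x y} → x ≈ y → g x ≈ g y) →
            (∀ x → f (g x) ≈ x) → (∀ x → g (f x) ≈ x) → Permutation′ q
  permute f g f-cong g-cong fg≈ gf≈ = permutation (to ∘ f ∘ from) (to ∘ g ∘ from)
    (λ i → ≡.trans (to-cong (trans (f-cong (strictlyInverseʳ _)) (fg≈ _))) (strictlyInverseˡ i))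
    (λ i → ≡.trans (to-cong (trans (g-cong (strictlyInverseʳ _)) (gf≈ _))) (strictlyInverseˡ i))

  -- Adding 1 permutes the field, hence does not change the sum of its elements.
  q·1≈0 : q · 1# ≈ 0#
  q·1≈0 = begin
    q · 1#                            ≈⟨ Σ₊.sum-replicate q ⟨
    Σ₊.sum {q} (λ _ → 1#)             ≈⟨ sum≈0 ⟩
    0#                                ∎
    where
    π = permute (_+ 1#) (_- 1#) +-congʳ +-congʳ
          (GroupProperties.//-rightDividesˡ +-group 1#) (GroupProperties.//-rightDividesʳ +-group 1#)
    total = Σ₊.sum {q} from
    shifted : total + Σ₊.sum {q} (λ _ → 1#) ≈ total
    shifted = begin
      total + Σ₊.sum {q} (λ _ → 1#)     ≈⟨ Σ₊.∑-distrib-+ {q} from (λ _ → 1#) ⟨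
      Σ₊.sum (λ i → from i + 1#)        ≈⟨ Σ₊.sum-cong-≋ (λ i → sym (strictlyInverseʳ (from i + 1#))) ⟩
      Σ₊.sum (λ i → from (π ⟨$⟩ʳ i))    ≈⟨ Σ₊.sum-permute from π ⟨
      total                             ∎
    sum≈0 = GroupProperties.∙-cancelˡ +-group total _ _ (trans shifted (sym (+-identityʳ total)))

  module Characteristic {p} (p-prime : Prime p) (k : ℕ) (q≡p^k : q ≡ p ℕ.^ k) where

    -- The vanishing element `q · 1#` is the `k`-th power of `p · 1#`, and there are no zero
    -- divisors.
    p·1≈0 : p · 1# ≈ 0#
    p·1≈0 with p · 1# ≟ 0#
    ... | yes p·1≈0 = p·1≈0
    ... | no  p·1≉0 = contradiction (trans (×-congˡ (≡.sym q≡p^k)) q·1≈0) (p^j·1≉0 k)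
      where
      p^j·1≉0 : ∀ j → ¬ (p ℕ.^ j) · 1# ≈ 0#
      p^j·1≉0 zero    1·1≈0 = 1≉0 (trans (sym (+-identityʳ 1#)) 1·1≈0)
      p^j·1≉0 (suc j) p^[1+j]·1≈0 =
        p^j·1≉0 j (cancel (trans (sym (×1-homo-* p (p ℕ.^ j))) p^[1+j]·1≈0) p·1≉0)

    [i*j]·1≈0 : ∀ i {j} → j · 1# ≈ 0# → (i ℕ.* j) · 1# ≈ 0#
    [i*j]·1≈0 i {j} j·1≈0 = trans (×1-homo-* i j) (trans (*-congˡ j·1≈0) (zeroʳ _))

    ·≈*  : ∀ i x → i · x ≈ (i · 1#) * x
    ·≈* i x = sym (trans (×-assoc-* i 1# x) (×-congʳ i (*-identityˡ x)))

    p∣i⇒i·x≈0 : ∀ {i} x → p ∣ i → i · x ≈ 0#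
    p∣i⇒i·x≈0 x (divides j ≡.refl) =
      trans (·≈* (j ℕ.* p) x) (trans (*-congʳ ([i*j]·1≈0 j p·1≈0)) (zeroˡ x))

    consecutive-≈0 : ∀ {a b} → 1 ℕ.+ a ≡ b → a · 1# ≈ 0# → b · 1# ≈ 0# → 1# ≈ 0#
    consecutive-≈0 ≡.refl a·1≈0 b·1≈0 = trans (sym (trans (+-congˡ a·1≈0) (+-identityʳ 1#))) b·1≈0

    -- Bézout's identity provides multiples of `p` and `i` that differ by 1; if both vanished in the
    -- field, so would `1#`.
    p∤i⇒i·1≉0 : ∀ {i} → ¬ p ∣ i → ¬ i · 1# ≈ 0#
    p∤i⇒i·1≉0 {i} p∤i i·1≈0 with coprime-Bézout coprime
      where
      coprime : Coprime p i
      coprime (d∣p , d∣i) with prime⇒irreducible p-prime d∣p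
      ... | inj₁ d≡1    = d≡1
      ... | inj₂ ≡.refl = contradiction d∣i p∤i
    ... | Bézout.Identity.+- x y eq = 1≉0 (consecutive-≈0 eq ([i*j]·1≈0 y i·1≈0) ([i*j]·1≈0 x p·1≈0))
    ... | Bézout.Identity.-+ x y eq = 1≉0 (consecutive-≈0 eq ([i*j]·1≈0 x p·1≈0) ([i*j]·1≈0 y i·1≈0))

    i·x≈0⇒x≈0 : ∀ {i x} → ¬ p ∣ i → i · x ≈ 0# → x ≈ 0#
    i·x≈0⇒x≈0 {i} {x} p∤i i·x≈0 = cancel (trans (sym (·≈* i x)) i·x≈0) (p∤i⇒i·1≉0 p∤i)

  -- Multiplication by x permutes the nonzero elements, hence does not change
  -- their product.
  x^[q-1]≈1 : ∀ {k} → q ≡ suc k → ∀ x → ¬ x ≈ 0# → x ^ k ≈ 1#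
  x^[q-1]≈1 {k} ≡.refl x x≉0 = begin
    x ^ k                              ≈⟨ Σ*.sum-replicate k ⟨
    Σ*.sum {k} (λ _ → x)               ≈⟨ Σ*.sum-cong-≋ {k} (λ i → reflexive (≡.sym (factor-≉ (nonzero i)))) ⟩
    Σ*.sum (removeAt factors i₀)       ≈⟨ *-identityˡ _ ⟨
    1# * Σ*.sum (removeAt factors i₀)  ≈⟨ *-congʳ (reflexive (factor-≈ (strictlyInverseʳ 0#))) ⟨
    factors i₀ * Σ*.sum (removeAt factors i₀) ≈⟨ Σ*.sum-remove {i = i₀} factors ⟨
    Σ*.sum factors                     ≈⟨ product≈1 ⟩
    1#                                 ∎
    where
    x⁻¹ = proj₁ (invert x x≉0)
    xx⁻¹≈1 = proj₂ (invert x x≉0)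
    i₀ = to 0#

    -- Zero is replaced by `1#` so that the products can run over the whole field. Removing the
    -- index of zero from `factors` then leaves exactly `k` factors `x`.
    unit factor : Carrier → Carrier
    unit y   = if does (y ≟ 0#) then 1# else y
    factor y = if does (y ≟ 0#) then 1# else x

    factors : Fin q → Carrier
    factors i = factor (from i)

    factor-≈ : ∀ {y} → y ≈ 0# → factor y ≡ 1#
    factor-≈ {y} y≈0 with y ≟ 0#
    ... | yes _  = ≡.refl
    ... | no y≉0 = contradiction y≈0 y≉0

    factor-≉ : ∀ {y} → ¬ y ≈ 0# → factor y ≡ x
    factor-≉ {y} y≉0 with y ≟ 0#
    ... | yes y≈0 = contradiction y≈0 y≉0
    ... | no _    = ≡.refl

    nonzero : ∀ i → ¬ from (punchIn i₀ i) ≈ 0#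
    nonzero i from≈0 = Fin.punchInᵢ≢i i₀ i
      (≡.trans (≡.sym (strictlyInverseˡ _)) (to-cong from≈0))

    unit-cong : ∀ {y z} → y ≈ z → unit y ≈ unit z
    unit-cong {y} {z} y≈z with y ≟ 0# | z ≟ 0#
    ... | yes _   | yes _   = refl
    ... | no _    | no _    = y≈z
    ... | yes y≈0 | no z≉0  = contradiction (trans (sym y≈z) y≈0) z≉0
    ... | no y≉0  | yes z≈0 = contradiction (trans y≈z z≈0) y≉0

    unit≉0 : ∀ y → ¬ unit y ≈ 0#
    unit≉0 y with y ≟ 0#
    ... | yes _   = 1≉0
    ... | no  y≉0 = y≉0

    unit-* : ∀ y → unit (x * y) ≈ factor y * unit y
    unit-* y with y ≟ 0# | x * y ≟ 0#
    ... | yes _   | yes _    = sym (*-identityˡ 1#)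
    ... | no _    | no _     = refl
    ... | yes y≈0 | no xy≉0  = contradiction (trans (*-congˡ y≈0) (zeroʳ x)) xy≉0
    ... | no y≉0  | yes xy≈0 = contradiction (cancel xy≈0 x≉0) y≉0

    π = permute (x *_) (x⁻¹ *_) *-congˡ *-congˡ
      (λ y → trans (sym (*-assoc x x⁻¹ y)) (trans (*-congʳ xx⁻¹≈1) (*-identityˡ y)))
      (λ y → trans (sym (*-assoc x⁻¹ x y)) (trans (*-congʳ (trans (*-comm x⁻¹ x) xx⁻¹≈1)) (*-identityˡ y)))

    product : Carrier
    product = Σ*.sum (unit ∘ from)

    product≉0 : ∀ {n} (f : Fin n → Carrier) → (∀ i → ¬ f i ≈ 0#) → ¬ Σ*.sum f ≈ 0#
    product≉0 {zero}  f f≉0 1≈0     = 1≉0 1≈0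
    product≉0 {suc n} f f≉0 f₀*fs≈0 = product≉0 (f ∘ suc) (f≉0 ∘ suc) (cancel f₀*fs≈0 (f≉0 zero))

    product≈ : product ≈ Σ*.sum factors * product
    product≈ = begin
      product                                    ≈⟨ Σ*.sum-permute (unit ∘ from) π ⟩
      Σ*.sum (λ i → unit (from (π ⟨$⟩ʳ i)))      ≈⟨ Σ*.sum-cong-≋ (λ i → unit-cong (strictlyInverseʳ (x * from i))) ⟩
      Σ*.sum (λ i → unit (x * from i))           ≈⟨ Σ*.sum-cong-≋ (λ i → unit-* (from i)) ⟩
      Σ*.sum (λ i → factors i * unit (from i))   ≈⟨ Σ*.∑-distrib-+ factors (unit ∘ from) ⟩
      Σ*.sum factors * product                   ∎

    product≈1 : Σ*.sum factors ≈ 1#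
    product≈1 with Σ*.sum factors ≟ 1#
    ... | yes ≈1 = ≈1
    ... | no  ≉1 = contradiction
      (cancel-- ≉1 (trans (sym product≈) (sym (*-identityˡ product))))
      (product≉0 (unit ∘ from) (unit≉0 ∘ from))

  x^q≈x : ∀ {k} → q ≡ suc k → ∀ x → x ^ q ≈ x
  x^q≈x {k} ≡.refl x with x ≟ 0#
  ... | yes x≈0 = trans (*-congʳ x≈0) (trans (zeroˡ (x ^ k)) (sym x≈0))
  ... | no  x≉0 = trans (*-congˡ (x^[q-1]≈1 ≡.refl x x≉0)) (*-identityʳ x)

-- The bound on the number of non-slopes.

module Slopes {c ℓ} (R : CommutativeRing c ℓ) (isField : IsField R)
  {q : ℕ} (F↔Fin : HasCardinality (CommutativeRing.setoid R) q) where

  open CommutativeRing R hiding (zero)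
  open IsField isField
  open FiniteField R isField F↔Fin
  open Sequences R
  open PolynomialFunctions R
  open Roots cancel
  open HasseDerivatives R
  open import Relation.Binary.Reasoning.Setoid setoid
  open Exp semiring using (_^_; ^-congˡ; ^-homo-*; ^-assocʳ)
  open MembershipSetoid setoid using (_∈_)
  open UniqueSetoid setoid using (Unique)

  length-power : ∀ k us → length (power k us) ≡ k ℕ.* length us
  length-power zero    us = ≡.refl
  length-power (suc k) us = ≡.trans (length-++ us) (≡.cong (length us ℕ.+_) (length-power k us))

  quoAll-polynomial : ∀ {i} {I : Set i} (line : I → Carrier → Carrier) → (∀ k → Affine (line k)) →
                      ∀ ks {s} → PolynomialSequence s →
                      PolynomialSequence λ y → quoAll (map (λ k → line k y) ks) (s y)
  quoAll-polynomial line affine []       poly = poly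
  quoAll-polynomial line affine (k ∷ ks) poly =
    quoAll-polynomial line affine ks (quo-polynomial (affine k) poly)

  -- All elements of the field are roots of X ^ q - X, so that it is divisible by
  -- the product of the X - u; by sparsity, the quotient starts like that of X ^ q.
  quoAll-𝟙-vanishes : ∀ {us k} → q ≡ suc k → Unique us → ∀ i → i < k → suc k < i ℕ.+ length us →
                      quoAll us 𝟙 i ≈ 0#
  quoAll-𝟙-vanishes {us} {k} q≡ us! i i<k q<i+k = begin
    quoAll us 𝟙 i                  ≈⟨ quoAll-agree {us} (Pointwise.refl refl) 𝟙≈ i i<k ⟩
    quoAll us (𝟙 ⊖ monomial k) i   ≈⟨ quoAll-degree us! (All.universal root us) degree i
                                        (≡.subst (λ l → suc k < i ℕ.+ l) (≡.sym (ℕ.+-identityʳ (length us))) q<i+k) ⟩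
    0#                             ∎
    where
    -- `X^q` and `X^q - X` first differ at index `k`, which is `q - 1`.
    𝟙≈ : Agree k 𝟙 (𝟙 ⊖ monomial k)
    𝟙≈ j j<k = begin
      𝟙 j                    ≈⟨ +-identityʳ _ ⟨
      𝟙 j + 0#               ≈⟨ +-congˡ (RingProperties.-0#≈0# ring) ⟨
      𝟙 j - 0#               ≈⟨ +-congˡ (-‿cong (monomial-≢ k j (ℕ.<⇒≢ j<k))) ⟨
      𝟙 j - monomial k j     ∎
    degree : Degree (suc k) 0 (𝟙 ⊖ monomial k)
    degree zero    ()
    degree (suc j) k<j = begin
      0# - monomial k (suc j) ≈⟨ +-identityˡ _ ⟩
      - monomial k (suc j)    ≈⟨ -‿cong (monomial-≢ k (suc j) (ℕ.>⇒≢ (ℕ.<-trans (ℕ.n<1+n k) (≡.subst (suc k <_) (ℕ.+-identityʳ (suc j)) k<j)))) ⟩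
      - 0#                    ≈⟨ RingProperties.-0#≈0# ring ⟩
      0#                      ∎
    -- From index `q` on, the entries of the quotient sequence are `u^j - u^(j - k)`, which is zero
    -- because `u^q = u`.
    root : ∀ u → Degree (suc k) 1 (quo u (𝟙 ⊖ monomial k))
    root u j k<j+1 = begin
      quo u (𝟙 ⊖ monomial k) j            ≈⟨ quo-⊖ u 𝟙 (monomial k) j ⟩
      quo u 𝟙 j - quo u (monomial k) j    ≈⟨ +-cong (quo-𝟙 u j) (-‿cong quo≈) ⟩
      u ^ j - u ^ suc h                   ≈⟨ +-congʳ u^j≈ ⟩
      u ^ suc h - u ^ suc h               ≈⟨ -‿inverseʳ (u ^ suc h) ⟩
      0#                                  ∎
      where
      h = j ∸ suc k
      j≡ : suc k ℕ.+ h ≡ j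
      j≡ = ℕ.m+[n∸m]≡n (s≤s⁻¹ (≡.subst (suc k <_) (ℕ.+-comm j 1) k<j+1))
      quo≈ : quo u (monomial k) j ≈ u ^ suc h
      quo≈ = trans (reflexive (≡.cong (quo u (monomial k)) (≡.trans (≡.sym j≡) (≡.sym (ℕ.+-suc k h)))))
                   (quo-monomial u k (suc h))
      u^j≈ : u ^ j ≈ u ^ suc h
      u^j≈ = begin
        u ^ j              ≈⟨ reflexive (≡.cong (u ^_) j≡) ⟨
        u ^ (suc k ℕ.+ h)   ≈⟨ ^-homo-* u (suc k) h ⟩
        u ^ suc k * u ^ h  ≈⟨ *-congʳ (trans (reflexive (≡.cong (u ^_) (≡.sym q≡))) (x^q≈x q≡ u)) ⟩
        u * u ^ h          ∎

  module _ {n} (el : Fin n → Carrier) (el-injective : ∀ {i j} → el i ≈ el j → i ≡ j) where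

    as : List Carrier
    as = map el (allFin n)

    length-as : length as ≡ n
    length-as = ≡.trans (length-map el (allFin n)) (length-tabulate {n = n} (λ i → i))

    as! : Unique as
    as! = Unique.map⁺ (≡.setoid (Fin n)) setoid el-injective (UniquePropositional.allFin⁺ n)

    line : Fin n × Fin n → Carrier → Carrier
    line (i , j) y = el j - el i * y

    pairs : List (Fin n × Fin n)
    pairs = cartesianProduct (allFin n) (allFin n)

    grid : Carrier → List Carrier
    grid y = map (λ k → line k y) pairs

    -- No two points of A × A span a line of slope y.
    NonDirection : Carrier → Set ℓ
    NonDirection y = ∀ k k′ → line k y ≈ line k′ y → k ≡ k′

    grid! : ∀ {y} → NonDirection y → Unique (grid y)
    grid! nondir = Unique.map⁺ (≡.setoid _) setoid (nondir _ _)
      (UniquePropositional.cartesianProduct⁺ (UniquePropositional.allFin⁺ n) (UniquePropositional.allFin⁺ n))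

    line-affine : ∀ k → Affine (line k)
    line-affine (i , j) = - el i , λ a y → begin
      el j - el i * y                                 ≈⟨ +-congˡ (-‿cong (*-congˡ (split a y))) ⟩
      el j - el i * (a + (y - a))                     ≈⟨ +-congˡ (-‿cong (distribˡ (el i) a (y - a))) ⟩
      el j - (el i * a + el i * (y - a))
        ≈⟨ +-congˡ (AbelianGroupProperties.⁻¹-∙-comm +-abelianGroup _ _) ⟨
      el j + (- (el i * a) - el i * (y - a))          ≈⟨ +-assoc _ _ _ ⟨
      (el j - el i * a) - el i * (y - a)
        ≈⟨ +-congˡ (trans (RingProperties.-‿distribˡ-* ring (el i) (y - a)) (*-comm _ _)) ⟩
      (el j - el i * a) + (y - a) * - el i            ∎
      where
      split : ∀ a y → y ≈ a + (y - a)
      split a y = trans (sym (GroupProperties.//-rightDividesˡ +-group a y)) (+-comm _ _)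

    -- At slope 0 the value `el j - el i * y` is just `el j`, so every `i` contributes one copy of
    -- `as`. This makes the grid at 0 a power of `Q`.
    lines-0 : ∀ is → Pointwise _≈_ (map (λ k → line k 0#) (cartesianProduct is (allFin n)))
                                  (power (length is) as)
    lines-0 []       = []
    lines-0 (i ∷ is) = ≡.subst (λ us → Pointwise _≈_ us (power (suc (length is)) as))
      (≡.sym (map-++ (λ k → line k 0#) (map (i ,_) (allFin n)) (cartesianProduct is (allFin n))))
      (Pointwise.++⁺ (row (allFin n)) (lines-0 is))
      where
      row : ∀ js → Pointwise _≈_ (map (λ k → line k 0#) (map (i ,_) js)) (map el js)
      row []       = []
      row (j ∷ js) = trans (+-congˡ (trans (-‿cong (zeroʳ (el i))) (RingProperties.-0#≈0# ring)))
                           (+-identityʳ (el j)) ∷ row js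

    length-allFin : length (allFin n) ≡ n
    length-allFin = length-tabulate {n = n} (λ i → i)

    grid-0 : Pointwise _≈_ (grid 0#) (power n as)
    grid-0 = ≡.subst (λ k → Pointwise _≈_ (grid 0#) (power k as)) length-allFin (lines-0 (allFin n))

    length-power-as : ∀ k → length (power k as) ≡ k ℕ.* n
    length-power-as k = ≡.trans (length-power k as) (≡.cong (k ℕ.*_) length-as)

    length-grid : ∀ y → length (grid y) ≡ n ℕ.* n
    length-grid y = ≡.trans (length-map (λ k → line k y) pairs)
      (≡.trans (≡.sym (length-map (λ k → line k 0#) pairs))
      (≡.trans (Pointwise.Pointwise-length grid-0) (length-power-as n)))

    module _ {ys : List Carrier} (ys! : Unique ys) (nondirs : All NonDirection ys)
             (0<l : 0 < length ys) (l<q : length ys < q) (n²≤q : n ℕ.* n ≤ q) where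

      private l = length ys

      1+[q-1]≡q : suc (pred q) ≡ q
      1+[q-1]≡q = ℕ.suc-pred q {{>-nonZero (ℕ.<-trans 0<l l<q)}}

      -- As a function of `y` the coefficient is a polynomial of degree at most `i`, and it is zero
      -- at the `l` distinct elements of `ys`; so it is zero everywhere, in particular at `y = 0`.
      grid-vanishes : ∀ i → i < l → q < i ℕ.+ n ℕ.* n → quoAll (grid 0#) 𝟙 i ≈ 0#
      grid-vanishes i i<l q<i+n² = polynomial-vanishes i
        (quoAll-polynomial line line-affine pairs (λ j → constant-polynomial j (𝟙 j)) i) ys! i<l
        (All.map (λ {y} nondir → quoAll-𝟙-vanishes (≡.sym 1+[q-1]≡q) (grid! nondir) i
                   -- Since `l < q`, the index `i` stays below `q - 1`.
                   (ℕ.<-≤-trans i<l (s≤s⁻¹ (≡.subst (l <_) (≡.sym 1+[q-1]≡q) l<q)))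
                   (≡.subst₂ (λ q k → q < i ℕ.+ k) (≡.sym 1+[q-1]≡q) (≡.sym (length-grid y)) q<i+n²)) nondirs) 0#

      private
        d₀ = q ∸ n ℕ.* n
        f G : Sequence
        f = truncate d₀ (quoAll (power n as) 𝟙)
        G = mulAll (power n as) f

      q≡ : length (power n as) ℕ.+ d₀ ≡ q
      q≡ = ≡.trans (≡.cong (ℕ._+ d₀) (length-power-as n)) (ℕ.m+[n∸m]≡n n²≤q)

      -- Below index `l`, truncation removes only coefficients that vanish by `grid-vanishes`, so
      -- modulo `T^l` the multiplication undoes the division. Thus `G` is `X^q` plus terms of degree
      -- at most `q - l`.
      G-agree : Agree l G 𝟙
      G-agree i i<l = trans
        (mulAll-agree (power n as) (truncate-agree d₀ λ j d₀<j j<l →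
          trans (sym (quoAll-cong grid-0 (λ _ → refl) j))
                (grid-vanishes j j<l (≡.subst (_< j ℕ.+ n ℕ.* n) (ℕ.m∸n+n≡m n²≤q) (ℕ.+-monoˡ-< (n ℕ.* n) d₀<j))))
          i i<l)
        (mulAll-quoAll (power n as) 𝟙 i)

      G₀≈1 : G 0 ≈ 1#
      G₀≈1 = G-agree 0 0<l

      f-degree : Degree q (length (power n as) ℕ.+ 0) f
      f-degree = ≡.subst (λ d → Degree d (length (power n as) ℕ.+ 0) f) q≡
                   (degree-+ (length (power n as)) (truncate-degree d₀ _))

      G-degree : Degree q 0 G
      G-degree = mulAll-degree (power n as) f-degree

      G-root : ∀ {u} → u ∈ power n as → Degree q 1 (quo u G)
      G-root u∈ = quo-mulAll-degree u∈ f-degree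

      ∈-power : ∀ {u} k → 0 < k → u ∈ as → u ∈ power k as
      ∈-power (suc k) _ u∈as = Membership.∈-++⁺ˡ setoid u∈as

      -- Otherwise, with P = suc k, G is S (X ^ P) for some S of degree m = q / P, and
      -- the P-th powers of the elements of A are more than m distinct roots of S.
      not-decimated : ∀ k m → q ≡ suc k ℕ.* m → m < n → ¬ (∀ i → ¬ suc k ∣ i → G i ≈ 0#)
      not-decimated k m q≡km m<n G≈0 = 1≉0 (begin
        1#             ≈⟨ G₀≈1 ⟨
        G 0            ≈⟨ reflexive (≡.cong G (ℕ.*-zeroʳ (suc k))) ⟨
        S 0            ≈⟨ mulAll-quoAll as^P S 0 ⟨
        mulAll as^P (quoAll as^P S) 0  ≈⟨ mulAll-cong as^P quotient≈0 0 ⟩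
        mulAll as^P 𝟘 0                ≈⟨ mulAll-𝟘 as^P 0 ⟩
        0#             ∎)
        where
        S : Sequence
        S i = G (suc k ℕ.* i)
        as^P = map (_^ suc k) as
        length≡ : length as^P ≡ n
        length≡ = ≡.trans (length-map _ as) length-as
        -- With `P = suc k`, raising to the `m`-th power inverts the `P`-th power, because
        -- `P * m = q` and `x^q = x`.
        P-injective : ∀ {x y} → x ^ suc k ≈ y ^ suc k → x ≈ y
        P-injective {x} {y} x^P≈y^P = begin
          x                  ≈⟨ x^q x ⟨
          (x ^ suc k) ^ m    ≈⟨ ^-congˡ m x^P≈y^P ⟩
          (y ^ suc k) ^ m    ≈⟨ x^q y ⟩
          y                  ∎
          where
          x^q : ∀ x → (x ^ suc k) ^ m ≈ x
          x^q x = trans (^-assocʳ x (suc k) m)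
                    (trans (reflexive (≡.cong (x ^_) (≡.sym q≡km)))
                           (x^q≈x (≡.sym 1+[q-1]≡q) x))
        roots : All (λ u → Degree m 1 (quo u S)) as^P
        roots = All.map⁺ (All.map⁺ (All.universal root (allFin n)))
          where
          root : ∀ i → Degree m 1 (quo (el i ^ suc k) S)
          root i j m<j+1 = trans (quo-decimate k (el i) G G≈0 j)
            (G-root (∈-power n (ℕ.≤-<-trans z≤n m<n) (Membership.∈-map⁺ (≡.setoid _) setoid
                      (λ { ≡.refl → refl }) (Membership.∈-tabulate⁺ (≡.setoid _) i)))
              (suc k ℕ.* j) (≡.subst₂ _<_ (≡.sym q≡km) (ℕ.+-comm 1 _)
                (s≤s (ℕ.*-monoʳ-≤ (suc k) (s≤s⁻¹ (≡.subst (m <_) (ℕ.+-comm j 1) m<j+1))))))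
        S-degree : Degree m 0 S
        S-degree j m<j = G-degree (suc k ℕ.* j)
          (≡.subst₂ _<_ (≡.sym q≡km) (≡.sym (ℕ.+-identityʳ _))
            (ℕ.*-monoʳ-< (suc k) (≡.subst (m <_) (ℕ.+-identityʳ j) m<j)))
        -- Dividing out `n > m` roots leaves a negative degree bound, so the quotient is zero, and
        -- with it `S`; but its leading coefficient is `G 0`, which is 1.
        quotient≈0 : quoAll as^P S ≋ 𝟘
        quotient≈0 i = quoAll-degree (Unique.map⁺ setoid setoid P-injective as!) roots S-degree i
          (ℕ.<-≤-trans (≡.subst (m <_) (≡.trans (≡.sym length≡) (≡.sym (ℕ.+-identityʳ _))) m<n) (ℕ.m≤n+m _ i))

      module _ {p} (p-prime : Prime p) (r : ℕ) (q≡p^[2r+1] : q ≡ p ℕ.^ (2 ℕ.* r ℕ.+ 1)) (p^r<n : p ℕ.^ r < n) where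

        open Characteristic p-prime (2 ℕ.* r ℕ.+ 1) q≡p^[2r+1]

        private
          instance
            p≢0 : NonZero p
            p≢0 = prime⇒nonZero p-prime
          P = p ℕ.^ suc r

        q≡P*p^r : q ≡ P ℕ.* p ℕ.^ r
        q≡P*p^r = ≡.trans q≡p^[2r+1] (≡.trans
          (≡.cong (p ℕ.^_) (≡.trans (ℕ.+-comm (2 ℕ.* r) 1) (≡.cong (λ s → suc (r ℕ.+ s)) (ℕ.+-identityʳ r))))
          (ℕ.^-distribˡ-+-* p (suc r) r))

        -- A bounded search over decidable conditions; its failure would contradict `not-decimated`.
        -- As `P` divides `q`, an exponent `q ∸ i` divisible by `P` means an index `i` divisible by
        -- `P`.
        coefficient : ∃[ i ] i < suc q × ¬ P ∣ q ∸ i × ¬ G i ≈ 0#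
        coefficient with ℕ.anyUpTo? (λ i → ¬? (P ∣? (q ∸ i)) ×-dec ¬? (G i ≟ 0#)) (suc q)
        ... | yes found = found
        ... | no none   = contradiction
          (λ i P∤i → G≈0 i (P∤i ∘ ≡.subst (_∣ i) (≡.sym sucP≡)))
          (not-decimated (pred P) (p ℕ.^ r) (≡.trans q≡P*p^r (≡.cong (ℕ._* p ℕ.^ r) (≡.sym sucP≡))) p^r<n)
          where
          sucP≡ : suc (pred P) ≡ P
          sucP≡ = ℕ.suc-pred P {{ℕ.m^n≢0 p (suc r)}}
          G≈0 : ∀ i → ¬ P ∣ i → G i ≈ 0#
          G≈0 i P∤i with G i ≟ 0# | ℕ.<-≤-connex q i
          ... | yes Gi≈0 | _        = Gi≈0
          ... | no _     | inj₁ q<i = G-degree i (≡.subst (q <_) (≡.sym (ℕ.+-identityʳ i)) q<i)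
          ... | no Gi≉0  | inj₂ i≤q = contradiction (i , s≤s i≤q , P∤q∸i , Gi≉0) none
            where
            P∤q∸i : ¬ P ∣ q ∸ i
            P∤q∸i P∣q∸i = P∤i (∣m+n∣m⇒∣n
              (≡.subst (P ∣_) (≡.trans (≡.sym q≡P*p^r) (≡.sym (ℕ.m∸n+n≡m i≤q))) (m∣m*n (p ℕ.^ r))) P∣q∸i)

        slope-count : ∃[ m ] m ≤ p ℕ.^ r × length ys ℕ.+ (n ∸ m) ℕ.* n ≤ q
        slope-count with coefficient
        ... | i , _ , P∤q∸i , Gi≉0 with p-adic-decomposition p-prime r (q ∸ i) P∤q∸i
        ...   | e , t , e≤r , q∸i≡ , p∤t = m , ℕ.^-monoʳ-≤ p e≤r , bound
          where
          -- The exponent of the chosen nonzero term is `m` times a number prime to `p`, so the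
          -- `m`-th Hasse derivative keeps this term.
          m = p ℕ.^ e
          L = power (n ∸ m) as

          p∤C : ¬ p ∣ (q ∸ i) C m
          p∤C = ≡.subst (λ j → ¬ p ∣ j C m) (≡.sym q∸i≡) (p∤[p^e*t]C[p^e] p-prime e p∤t)

          -- Here `e ≤ r < 2r + 1` gives `0 < m < q`, so the term `X^q` is killed.
          p∣C : p ∣ q C m
          p∣C = ≡.subst (λ j → p ∣ j C m) (≡.trans (ℕ.*-identityʳ _) (≡.sym q≡p^[2r+1]))
            (p∣[p^e*t]Ck p-prime (2 ℕ.* r ℕ.+ 1) 1 (ℕ.m^n>0 p e)
              (ℕ.^-monoʳ-< p (nonTrivial⇒n>1 p {{prime⇒nonTrivial p-prime}})
                (ℕ.≤-<-trans e≤r (≡.subst (r <_) (ℕ.+-comm 1 (2 ℕ.* r)) (s≤s (ℕ.m≤m+n r _))))))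

          hasse-agree : Agree l (hasse m q G) 𝟘
          hasse-agree zero    0<l = p∣i⇒i·x≈0 (G 0) p∣C
          hasse-agree (suc j) j<l = ·-zeroʳ ((q ∸ suc j) C m) (G-agree (suc j) j<l)

          divisible : Divisible L q m (hasse m q G)
          divisible = ≡.subst (λ d → Divisible L d m (hasse m d G)) q≡
            (hasse-divisible n (truncate-degree d₀ _) m)
          open Divisible divisible

          quotient-agree : Agree l quotient 𝟘
          quotient-agree j j<l = begin
            quotient j                       ≈⟨ quoAll-mulAll L quotient j ⟨
            quoAll L (mulAll L quotient) j   ≈⟨ quoAll-congʳ L equality j ⟨
            quoAll L (hasse m q G) j         ≈⟨ quoAll-agree {L} (Pointwise.refl refl) hasse-agree j j<l ⟩
            quoAll L 𝟘 j                     ≈⟨ quoAll-𝟘 L j ⟩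
            0#                               ∎

          -- Otherwise the quotient would vanish below `l` by `quotient-agree` and from `l` on by
          -- its degree; the whole derivative would be zero, contrary to the choice of `i`.
          ¬q< : ¬ q < l ℕ.+ (length L ℕ.+ m)
          ¬q< q< = Gi≉0 (i·x≈0⇒x≈0 p∤C (trans (equality i) (trans (mulAll-cong L quotient≈0 i) (mulAll-𝟘 L i))))
            where
            quotient≈0 : quotient ≋ 𝟘
            quotient≈0 j with ℕ.<-≤-connex j l
            ... | inj₁ j<l = quotient-agree j j<l
            ... | inj₂ l≤j = quotient-degree j (ℕ.<-≤-trans q< (ℕ.+-monoˡ-≤ _ l≤j))

          -- The additional summand `m` is given away.
          bound : l ℕ.+ (n ∸ m) ℕ.* n ≤ q
          bound = ℕ.≤-trans (ℕ.+-monoʳ-≤ l (ℕ.≤-trans (ℕ.≤-reflexive (≡.sym (length-power-as (n ∸ m))))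
                                                       (ℕ.m≤m+n (length L) m)))
                            (ℕ.≮⇒≥ ¬q<)

-- Finite Heyting fields as classical fields.

module FiniteHeytingField {c ℓ₁ ℓ₂} (F : HeytingField c ℓ₁ ℓ₂) {q : ℕ}
  (F↔Fin : HasCardinality (FieldSubsets.setoid F) q) where

  open FieldSubsets F hiding (_≈_; Carrier; setoid)

  commutativeRing : CommutativeRing c ℓ₁
  commutativeRing = HeytingCommutativeRing.commutativeRing (HeytingField.heytingCommutativeRing F)

  open CommutativeRing commutativeRing hiding (zero)
  open HeytingField F using (_#_; #⇒invertible; invertible⇒#; #-irrefl; tight)
  open Inverse F↔Fin using (to; from; strictlyInverseˡ; strictlyInverseʳ; to-cong)
  open import Relation.Binary.Reasoning.Setoid setoid
  open SemiringSolver commutativeSemiring using (solve; _:+_; _:*_; _:=_)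

  infix 4 _≟_
  _≟_ : Decidable _≈_
  _≟_ = cardinality⇒dec setoid F↔Fin

  x-0≈x : ∀ x → x - 0# ≈ x
  x-0≈x x = trans (+-congˡ (RingProperties.-0#≈0# ring)) (+-identityʳ x)

  -- If `1#` were zero, all elements would be equal, so `0# - 0#` would be invertible and `0#` apart
  -- from itself.
  1≉0 : ¬ 1# ≈ 0#
  1≉0 1≈0 = #-irrefl refl (invertible⇒# {0#} {0#} (0# , ≈1 , ≈1))
    where
    ≈1 : ∀ {x} → x ≈ 1#
    ≈1 {x} = begin
      x       ≈⟨ *-identityˡ x ⟨
      1# * x  ≈⟨ *-congʳ 1≈0 ⟩
      0# * x  ≈⟨ zeroˡ x ⟩
      0#      ≈⟨ 1≈0 ⟨
      1#      ∎

  -- By searching the field: tightness excludes that no inverse exists.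
  invert : ∀ x → ¬ x ≈ 0# → ∃ λ y → x * y ≈ 1#
  invert x x≉0 with Fin.any? (λ i → x * from i ≟ 1#)
  ... | yes (i , xy≈1) = from i , xy≈1
  ... | no  none       = contradiction (proj₁ (tight x 0#) λ x#0 → none (search x#0)) x≉0
    where
    search : x # 0# → ∃ λ i → x * from i ≈ 1#
    search x#0 = let y , _ , [x-0]y≈1 = #⇒invertible x#0 in
      to y , trans (*-congˡ (strictlyInverseʳ y)) (trans (*-congʳ (sym (x-0≈x x))) [x-0]y≈1)

  isField : IsField commutativeRing
  isField = record { 1≉0 = 1≉0 ; invert = invert }

  ≉0⇒#0 : ∀ {x} → ¬ x ≈ 0# → x # 0#
  ≉0⇒#0 {x} x≉0 = let y , xy≈1 = invert x x≉0 in
    invertible⇒# (y , trans (*-congˡ (x-0≈x x)) (trans (*-comm y x) xy≈1) , trans (*-congʳ (x-0≈x x)) xy≈1)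

  *-inverse : ∀ {x} (x#0 : x # 0#) → x * inverse x#0 ≈ 1#
  *-inverse {x} x#0 = trans (*-congʳ (sym (x-0≈x x))) (proj₂ (proj₂ (#⇒invertible x#0)))

  -- Together with `quotient⁻` this trades the inverse obtained from apartness for the decidable
  -- equation `z * y ≈ x`.
  quotient⁺ : ∀ {x y z} → ¬ y ≈ 0# → z * y ≈ x → IsQuotient x y (just z)
  quotient⁺ {x} {y} {z} y≉0 zy≈x = finite y#0 (begin
    z                      ≈⟨ *-identityʳ z ⟨
    z * 1#                 ≈⟨ *-congˡ (*-inverse y#0) ⟨
    z * (y * inverse y#0)  ≈⟨ *-assoc z y _ ⟨
    z * y * inverse y#0    ≈⟨ *-congʳ zy≈x ⟩
    x * inverse y#0        ∎)
    where y#0 = ≉0⇒#0 y≉0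

  quotient⁻ : ∀ {x y z} → IsQuotient x y (just z) → ¬ y ≈ 0# × z * y ≈ x
  quotient⁻ {x} {y} {z} (finite y#0 z≈) = (λ y≈0 → proj₂ (tight y 0#) y≈0 y#0) , (begin
    z * y                    ≈⟨ *-congʳ z≈ ⟩
    x * inverse y#0 * y      ≈⟨ solve 3 (λ x i y → x :* i :* y := x :* (y :* i)) refl x _ y ⟩
    x * (y * inverse y#0)    ≈⟨ *-congˡ (*-inverse y#0) ⟩
    x * 1#                   ≈⟨ *-identityʳ x ⟩
    x                        ∎)

  elements : List Carrier
  elements = tabulate from

  elements! : UniqueSetoid.Unique setoid elements
  elements! = Unique.tabulate⁺ setoid λ {i} {j} from≈ →
    ≡.trans (≡.sym (strictlyInverseˡ i)) (≡.trans (to-cong from≈) (strictlyInverseˡ j))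

  open MembershipSetoid setoid using (_∈_)

  ∈-elements : ∀ x → x ∈ elements
  ∈-elements x = Membership.∈-resp-≈ setoid (strictlyInverseʳ x) (Membership.∈-tabulate⁺ setoid (to x))

  -- Slopes determined by a set, and the count of directions.

  module _ {ℓ} (A : Pred Carrier ℓ) {n} (A↔Fin : SubsetHasCardinality setoid A n) where

    private
      module A = Inverse A↔Fin

    el : Fin n → Carrier
    el i = proj₁ (A.from i)

    el∈A : ∀ i → A (el i)
    el∈A i = proj₂ (A.from i)

    el-injective : ∀ {i j} → el i ≈ el j → i ≡ j
    el-injective {i} {j} eli≈elj =
      ≡.trans (≡.sym (A.strictlyInverseˡ i)) (≡.trans (A.to-cong {A.from i} {A.from j} eli≈elj) (A.strictlyInverseˡ j))

    el-surjective : ∀ {x} → A x → ∃ λ i → el i ≈ x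
    el-surjective {x} x∈A = A.to (x , x∈A) , A.strictlyInverseʳ (x , x∈A)

    -- The finite directions, with indices for elements of `A` and the denominator cleared, so that
    -- a finite search decides them.
    Slope : Pred Carrier ℓ₁
    Slope z = ∃[ i ] ∃[ j ] ∃[ k ] ∃[ l ] ¬ el k ≈ el l × z * (el k - el l) ≈ el i - el j

    slope? : U.Decidable Slope
    slope? z = Fin.any? λ i → Fin.any? λ j → Fin.any? λ k → Fin.any? λ l →
      ¬? (el k ≟ el l) ×-dec (z * (el k - el l) ≟ el i - el j)

    slope-resp : Slope Respects _≈_
    slope-resp z≈w (i , j , k , l , k≉l , z≈) = i , j , k , l , k≉l , trans (*-congʳ (sym z≈w)) z≈

    Direction : Pred (Maybe Carrier) _
    Direction = (A ⊖ A) ⊘ (A ⊖ A)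

    slope⇒direction : ∀ {z} → Slope z → Direction (just z)
    slope⇒direction (i , j , k , l , k≉l , z≈) =
      el i - el j , el k - el l ,
      (el i , el j , el∈A i , el∈A j , refl) , (el k , el l , el∈A k , el∈A l , refl) ,
      quotient⁺ (λ k-l≈0 → k≉l (GroupProperties.x∙y⁻¹≈ε⇒x≈y +-group _ _ k-l≈0)) z≈

    direction⇒slope : ∀ {z} → Direction (just z) → Slope z
    direction⇒slope {z} (x , y , (a , b , a∈A , b∈A , x≈) , (a′ , b′ , a′∈A , b′∈A , y≈) , x/y) =
      let i , a≈ = el-surjective a∈A ; k , a′≈ = el-surjective a′∈A
          j , b≈ = el-surjective b∈A ; l , b′≈ = el-surjective b′∈A
          y≉0 , zy≈x = quotient⁻ x/y
          y≈′ : y ≈ el k - el l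
          y≈′ = trans y≈ (sym (+-cong a′≈ (-‿cong b′≈)))
      in i , j , k , l ,
         (λ k≈l → y≉0 (trans y≈′ (GroupProperties.x≈y⇒x∙y⁻¹≈ε +-group k≈l))) ,
         trans (*-congˡ (sym y≈′)) (trans zy≈x (trans x≈ (sym (+-cong a≈ (-‿cong b≈)))))

    -- Equal values `b - a z` and `b′ - a′ z` give `z (a - a′) = b - b′`. So `z` is a slope unless
    -- `a = a′`, and then `b = b′` as well.
    ¬slope⇒nonDirection : ∀ {z} → ¬ Slope z → Slopes.NonDirection commutativeRing isField F↔Fin el el-injective z
    ¬slope⇒nonDirection {z} ¬slope (i , j) (i′ , j′) eq with i Fin.≟ i′
    ... | yes ≡.refl = ≡.cong (i ,_) (el-injective (GroupProperties.∙-cancelʳ +-group _ _ _ eq))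
    ... | no i≢i′ = contradiction (j , j′ , i , i′ , i≢i′ ∘ el-injective , (begin
      z * (el i - el i′)              ≈⟨ trans (*-comm z _) (RingProperties.[y-z]x≈yx-zx ring z (el i) (el i′)) ⟩
      u - v                           ≈⟨ rearrange ⟩
      el j - el j′                    ∎)) ¬slope
      where
      u = el i * z
      v = el i′ * z
      rearrange : u - v ≈ el j - el j′
      rearrange = begin
        u - v                              ≈⟨ trans (sym (+-identityʳ _)) (+-congˡ (sym (-‿inverseʳ (el j′)))) ⟩
        (u - v) + (el j′ - el j′)
          ≈⟨ solve 4 (λ u v′ w w′ → (u :+ v′) :+ (w :+ w′) := (w :+ v′) :+ (u :+ w′)) refl u (- v) (el j′) (- el j′) ⟩
        (el j′ - v) + (u - el j′)          ≈⟨ +-congʳ eq ⟨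
        (el j - u) + (u - el j′)
          ≈⟨ solve 4 (λ a u′ u w′ → (a :+ u′) :+ (u :+ w′) := (a :+ w′) :+ (u′ :+ u)) refl (el j) (- u) u (- el j′) ⟩
        (el j - el j′) + (- u + u)         ≈⟨ trans (+-congˡ (-‿inverseˡ u)) (+-identityʳ _) ⟩
        el j - el j′                       ∎

    slopes nonslopes : List Carrier
    slopes    = filter slope? elements
    nonslopes = filter (¬? ∘ slope?) elements

    nonslopes-nonDirection : All (Slopes.NonDirection commutativeRing isField F↔Fin el el-injective) nonslopes
    nonslopes-nonDirection = All.map ¬slope⇒nonDirection (All.all-filter (¬? ∘ slope?) elements)

    slopes+nonslopes≡q : length slopes ℕ.+ length nonslopes ≡ q
    slopes+nonslopes≡q = ≡.trans (length-filter-¬ slope? elements) (length-tabulate from)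

    directions : List (Maybe Carrier)
    directions = nothing ∷ map just slopes

    directions! : UniqueSetoid.Unique F∪∞ directions
    directions! = All.map⁺ (All.universal (λ _ ()) slopes) ∷
      Unique.map⁺ setoid F∪∞ Maybe.drop-just (Unique.filter⁺ setoid slope? elements!)

    directions-cardinality : Fin n → SubsetHasCardinality F∪∞ Direction (suc (length slopes))
    directions-cardinality i = ≡.subst (SubsetHasCardinality F∪∞ Direction) (≡.cong suc (length-map just slopes))
      (list⇒cardinality F∪∞ directions!
        -- The point at infinity is attained as `0/0`; the index `i` ensures that `A` is inhabited.
        ((0# , 0# , 0∈A-A , 0∈A-A , infinite refl) ∷
          All.map⁺ (All.map slope⇒direction (All.all-filter slope? elements)))
        complete)
      where
      0∈A-A : (A ⊖ A) 0#
      0∈A-A = el i , el i , el∈A i , el∈A i , sym (-‿inverseʳ (el i))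
      complete : ∀ {z} → Direction z → MembershipSetoid._∈_ F∪∞ z directions
      complete {nothing} _ = here Maybe.nothing
      complete {just z}  d = there (Membership.∈-map⁺ setoid F∪∞ Maybe.just
        (Membership.∈-filter⁺ setoid slope? slope-resp (∈-elements z) (direction⇒slope d)))

    -- Two distinct elements of `A` give the slope 0. This keeps the number of non-slopes below `q`.
    slopes-nonempty : 1 < n → 0 < length slopes
    slopes-nonempty 1<n = Membership.∈-length setoid
      (Membership.∈-filter⁺ setoid slope? slope-resp (∈-elements 0#)
        (i₀ , i₀ , i₀ , i₁ , (λ i₀≈i₁ → i₀≢i₁ (el-injective i₀≈i₁)) , trans (zeroˡ _) (sym (-‿inverseʳ (el i₀)))))
      where
      i₀ = fromℕ< (ℕ.<-trans z<s 1<n)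
      i₁ = fromℕ< 1<n
      i₀≢i₁ : ¬ i₀ ≡ i₁
      i₀≢i₁ i₀≡i₁ with () ← Fin.fromℕ<-injective 0 1 (ℕ.<-trans z<s 1<n) 1<n i₀≡i₁

    module _ {p} (r : ℕ) (p-prime : Prime p) (q≡ : q ≡ p ℕ.^ (2 ℕ.* r ℕ.+ 1))
             (2p^r<n : 2 ℕ.* p ℕ.^ r < n) (n²<q : n ℕ.* n < q) where

      1<n : 1 < n
      1<n = ℕ.≤-<-trans (ℕ.≤-trans (ℕ.m^n>0 p {{prime⇒nonZero p-prime}} r) (ℕ.m≤n*m (p ℕ.^ r) 2)) 2p^r<n

      nonslopes<q : length nonslopes < q
      nonslopes<q = ≡.subst (length nonslopes <_) slopes+nonslopes≡q (ℕ.m<n+m (length nonslopes) (slopes-nonempty 1<n))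

      nonslopes! : UniqueSetoid.Unique setoid nonslopes
      nonslopes! = Unique.filter⁺ setoid (¬? ∘ slope?) elements!

      count : 0 < length nonslopes → ∃[ m ] m ≤ p ℕ.^ r × length nonslopes ℕ.+ (n ∸ m) ℕ.* n ≤ q
      count 0<l = Slopes.slope-count commutativeRing isField F↔Fin el el-injective {nonslopes}
        nonslopes! nonslopes-nonDirection 0<l nonslopes<q (ℕ.<⇒≤ n²<q) p-prime r q≡
        (ℕ.≤-<-trans (ℕ.m≤n*m (p ℕ.^ r) 2) 2p^r<n)

      many-slopes : n ℕ.* n ≤ 2 ℕ.* length slopes
      many-slopes = [ (λ 0<l → let m , m≤p^r , bound = count 0<l in
                        n²≤2s {l = length nonslopes} m (ℕ.≤-trans (ℕ.*-monoʳ-≤ 2 m≤p^r) (ℕ.<⇒≤ 2p^r<n))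
                          slopes+nonslopes≡q bound)
                    -- Without non-slopes the polynomial argument has no leading term to work with,
                    -- but then all `q` elements are slopes and `n ℕ.* n < q` suffices.
                    , (λ l≤0 → ℕ.≤-trans (ℕ.<⇒≤ n²<q) (ℕ.≤-trans (ℕ.≤-reflexive (≡.sym slopes+nonslopes≡q))
                        (ℕ.+-monoʳ-≤ (length slopes) (ℕ.≤-trans l≤0 z≤n)))) ]′
                    (ℕ.<-≤-connex 0 (length nonslopes))

open import Data.Nat.Base using (_+_; _*_; _^_)

corollary1p8 : ∀ {c ℓ₁ ℓ₂ ℓ : Level}
    (p r q : ℕ) → Prime p → q ≡ p ^ (2 * r + 1) →
    (F : HeytingField c ℓ₁ ℓ₂) → let open FieldSubsets F in
    HasCardinality setoid q →
    (A : Pred Carrier ℓ) → A Respects _≈_ →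
    (n : ℕ) → SubsetHasCardinality setoid A n →
    2 * p ^ r < n → n ^ 2 < q →
    ∃[ m ] (SubsetHasCardinality F∪∞ ((A ⊖ A) ⊘ (A ⊖ A)) m × n ^ 2 < 2 * m)
corollary1p8 p r q p-prime q≡ F F↔Fin A _ n A↔Fin 2p^r<n n^2<q =
  -- The successor counts the point at infinity, and makes the final inequality strict.
  suc (length (slopes A A↔Fin)) ,
  directions-cardinality A A↔Fin (fromℕ< (ℕ.≤-<-trans z≤n 2p^r<n)) ,
  ≡.subst (_< 2 * suc (length (slopes A A↔Fin))) (≡.sym n^2≡n*n)
    (ℕ.≤-<-trans (many-slopes A A↔Fin r p-prime q≡ 2p^r<n (≡.subst (_< q) n^2≡n*n n^2<q))
      (ℕ.*-monoʳ-< 2 (ℕ.n<1+n _)))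
  where
  open FiniteHeytingField F F↔Fin
  n^2≡n*n : n ^ 2 ≡ n * n
  n^2≡n*n = ≡.cong (n *_) (ℕ.*-identityʳ n)
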